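{- Let $S=\{l,m\}$ with $2\le l<m$ be admissible (i.e. $m\ge l+2$). In the expansion $p(S;n)=\sum_{k\ge0}C^S_k\binom{n-m}{k}$ we have $C^S_0=0$, and for $k\ge1$ $$C^S_k=-2\binom{m-1}{k+m-l}\chi(m-l\text{ even})+\sum_{j=0}^{m-l-2}(-1)^j\left[\binom{m-j-2}{l-1}-1\right]\binom{m}{k+j+1}.$$ Furthermore, $C^S_k\ge0$ for $k\ge (m-2)/2$.
   Context: For a permutation $\pi=a_1\ldots a_n$ of $\{1,\ldots,n\}$, an index $i$ is a peak if $a_{i-1}<a_i>a_{i+1}$. $P(S;n)$ is the set of permutations of $\{1,\dots,n\}$ whose set of peaks is exactly $S$. For an admissible finite set $S$, the peak polynomial $p(S;n)$ is the unique polynomial with $\#P(S;n)=p(S;n)2^{n-\#S-1}$ for all $n>\max S$. The coefficients $C^S_k$ are defined by $p(S;n)=\sum_{k\ge0}C^S_k\binom{n-m}{k}$ where $m=\max S$. $\chi(\text{statement})$ is $1$ if the statement is true and $0$ otherwise. Convention: $\binom{a}{b}=0$ if $b<0$ or $b>a$. -}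

module Defs where

open import Data.Bool using (Bool; true; false; if_then_else_; _∧_)
open import Data.Nat as ℕ using (ℕ; zero; suc; _∸_; _<ᵇ_; _≡ᵇ_; _%_)
open import Data.Nat.Combinatorics using (_C_)
open import Data.List using (List; []; _∷_; map; filter; filterᵇ; concatMap; length; upTo; foldr; applyUpTo)
import Data.List.Properties as LP
open import Data.List.Relation.Unary.Unique.DecPropositional ℕ._≟_ using (Unique; unique?)
open import Data.Integer as ℤ using (ℤ; +_; -_; _-_)
open import Data.Product using (Σ; ∃; _×_)
open import Relation.Binary.PropositionalEquality using (_≡_)
open import Relation.Nullary using (does)

words : ℕ → ℕ → List (List ℕ)
words n zero    = [] ∷ []
words n (suc k) = concatMap (λ w → map (_∷ w) (map suc (upTo n))) (words n k)

perms : ℕ → List (List ℕ)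
perms n = filter unique? (words n n)

-- 1-based lookup a_i (default 0 out of range; only used in range)
at : List ℕ → ℕ → ℕ
at []       _             = 0
at (x ∷ xs) zero          = 0
at (x ∷ xs) (suc zero)    = x
at (x ∷ xs) (suc (suc i)) = at xs (suc i)

isPeak : List ℕ → ℕ → Bool
isPeak w i = (1 <ᵇ i) ∧ (i <ᵇ length w) ∧ (at w (i ∸ 1) <ᵇ at w i) ∧ (at w (suc i) <ᵇ at w i)

peaks : List ℕ → List ℕ
peaks w = filterᵇ (isPeak w) (upTo (suc (length w)))

countP : ℕ → ℕ → ℕ → ℕ
countP l m n = length (filter (λ w → LP.≡-dec ℕ._≟_ (peaks w) (l ∷ m ∷ [])) (perms n))

sumℤ : List ℤ → ℤ
sumℤ = foldr ℤ._+_ (+ 0)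

Σ< : ℕ → (ℕ → ℤ) → ℤ
Σ< K f = sumℤ (applyUpTo f K)

-- C is "the" coefficient sequence of p({l,m};n) in the basis binom(n-m,k):
-- C has finite support (C k = 0 for k ≥ K) and for all n > m
--   #P({l,m};n) = 2^{n-#S-1} · Σ_k C_k binom(n-m,k),   with #S = 2.
IsPeakCoeffs : ℕ → ℕ → (ℕ → ℤ) → Set
IsPeakCoeffs l m c =
  Σ ℕ λ K →
    ((k : ℕ) → K ℕ.≤ k → c k ≡ + 0) ×
    ((n : ℕ) → m ℕ.< n →
      + countP l m n ≡ + (2 ℕ.^ (n ∸ 3)) ℤ.* Σ< K (λ k → c k ℤ.* + ((n ∸ m) C k)))

χ-even : ℕ → ℤ
χ-even d = if d % 2 ≡ᵇ 0 then + 1 else + 0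

formula : ℕ → ℕ → ℕ → ℤ
formula l m k =
  (- (+ 2 ℤ.* + ((m ∸ 1) C (k ℕ.+ (m ∸ l))) ℤ.* χ-even (m ∸ l)))
  ℤ.+ Σ< (m ∸ l ∸ 1) (λ j →
        ((- + 1) ℤ.^ j) ℤ.* ((+ ((m ∸ j ∸ 2) C (l ∸ 1)) - + 1) ℤ.* + (m C (k ℕ.+ j ℕ.+ 1))))

formulaC : ℕ → ℕ → ℕ → ℤ
formulaC l m zero    = + 0
formulaC l m (suc k) = formula l m (suc k)

{-# OPTIONS --safe #-}
module Submission where

-- A permutation enters only through its signature, the word of ascents (true) and
-- descents (false).  Inserting the maximum turns the signatures of size n into those of
-- size n + 1, and tracking on which side of a fixed cut it lands gives
--   Σ_w A(first a letters) B(last b letters) = C(a+b, b) · Σ A · Σ B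
-- for all A, B depending on signatures only.  For "peak set S" and "no peaks" the left
-- side counts the permutations with peak set S, S ∪ {a} or S ∪ {a + 1}; this recurrence,
-- with 2^(n-1) peakless permutations, yields #P({l};n) = 2^(n-2) (C(n-1,l-1) - 1) and then
-- #P({l,m};n) as an alternating sum by induction on m - l.  Vandermonde's identity expands
-- that sum in the basis C(n-m,k), and C_0 = 0 because m is not a peak when n = m.
-- For 2k ≥ m - 2 the alternating sum has decreasing terms, the last of which absorbs
-- -2 C(m-1,k+m-l).

open import Defs
open import Data.Bool using (Bool; true; false; _∧_; not; T; if_then_else_)
open import Data.Empty using (⊥-elim)
open import Data.Integer as ℤ using (ℤ; +_)
import Data.Integer.Properties as ℤ
import Data.Integer.Solver as ℤ
open import Data.List using (List; []; _∷_; [_]; _++_; map; filter; filterᵇ; concatMap; length; upTo; applyUpTo; take; drop)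
open import Data.List.Membership.Propositional using (_∈_; find; lose)
open import Data.List.Membership.Propositional.Properties using (∈-∃++; ∈-++⁻; ∈-++⁺ˡ; ∈-++⁺ʳ; ∈-map⁺; ∈-map⁻; ∈-upTo⁺; ∈-upTo⁻; ∈-concatMap⁺; ∈-concatMap⁻; ∈-filter⁺; ∈-filter⁻)
open import Data.List.Membership.Propositional.Properties.WithK using (unique∧set⇒bag)
open import Data.List.Properties using (filter-all; filter-accept; filter-reject; length-map; length-upTo; map-∘; map-++; ≡-dec; ++-cancelˡ; ++-identityʳ; map-id; length-take; ∷-injective; ∷-injectiveˡ)
open import Data.List.Relation.Binary.BagAndSetEquality using (∼bag⇒↭)
open import Data.List.Relation.Binary.Permutation.Propositional using (_↭_; prep; swap; ↭-refl; ↭-sym; ↭-trans; ↭⇒↭ₛ)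
open import Data.List.Relation.Binary.Permutation.Propositional.Properties using (shift; ↭-length; All-resp-↭) renaming (map⁺ to ↭-map⁺)
open import Data.List.Relation.Binary.Permutation.Setoid.Properties using (Unique-resp-↭)
open import Data.List.Relation.Unary.All as All using (All; []; _∷_)
import Data.List.Relation.Unary.All.Properties as All
open import Data.List.Relation.Unary.AllPairs using ([]; _∷_)
open import Data.List.Relation.Unary.Any as Any using (here; there)
open import Data.List.Relation.Unary.Unique.Propositional using (Unique)
import Data.List.Relation.Unary.Unique.Propositional.Properties as Unique
open import Data.Nat using (ℕ; zero; suc; _+_; _*_; _∸_; _≤_; _<_; z≤n; s≤s; _<ᵇ_; _≟_; _^_; _≤′_; ≤′-refl; ≤′-step)
open import Data.List.Relation.Unary.Unique.DecPropositional _≟_ using (unique?)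
open import Data.Nat.Combinatorics using (_C_; nCn≡1; nCk+nC[k+1]≡[n+1]C[k+1]; nCk≡nC[n∸k]; k>n⇒nCk≡0)
open import Data.Nat.ListAction using (sum)
open import Data.Nat.ListAction.Properties using (sum-++; sum-↭)
open import Data.Nat.Properties
open import Data.Nat.Solver using (module +-*-Solver)
open import Data.Product using (_×_; _,_; proj₁; proj₂; ∃)
open import Data.Sum using (inj₁; inj₂)
open import Function using (_∘_; mk⇔)
open import Relation.Binary.Definitions using (tri<; tri≈; tri>)
open import Relation.Binary.PropositionalEquality hiding ([_])
import Relation.Binary.PropositionalEquality.Properties as ≡
open import Relation.Nullary using (¬_; ¬?; yes; no; Dec; does)

-- Permutations by insertion of the maximum

unique-concatMap : {A B : Set} (f : A → List B) {xs : List A} → Unique xs →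
  All (Unique ∘ f) xs →
  (∀ {x y z} → x ∈ xs → y ∈ xs → z ∈ f x → z ∈ f y → x ≡ y) →
  Unique (concatMap f xs)
unique-concatMap f [] [] _ = []
unique-concatMap f (x∉ ∷ uxs) (ux ∷ us) disj =
  Unique.++⁺ ux (unique-concatMap f uxs us (λ p q → disj (there p) (there q)))
    λ (z∈x , z∈xs) → let y , y∈xs , z∈y = find (∈-concatMap⁻ f z∈xs)
                     in All.lookup x∉ y∈xs (disj (here refl) (there y∈xs) z∈x z∈y)

-- Pigeonhole principle: the occurrence of the head is cut out of `ys`, and the other entries of
-- `xs` stay inside what remains because they avoid the head.
unique-⊆-length : {A : Set} {xs ys : List A} → Unique xs → All (_∈ ys) xs → length xs ≤ length ys
unique-⊆-length [] [] = z≤n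
unique-⊆-length {xs = x ∷ xs} (x∉ ∷ uxs) (x∈ ∷ xs⊆) with ∈-∃++ x∈
... | as , bs , refl = subst (suc (length xs) ≤_) (sym (↭-length (shift x as bs)))
  (s≤s (unique-⊆-length uxs (All.zipWith remove (x∉ , xs⊆))))
  where
  remove : ∀ {y} → x ≢ y × y ∈ as ++ x ∷ bs → y ∈ as ++ bs
  remove (x≢y , y∈) with ∈-++⁻ as y∈
  ... | inj₁ p = ∈-++⁺ˡ p
  ... | inj₂ (here refl) = ⊥-elim (x≢y refl)
  ... | inj₂ (there p) = ∈-++⁺ʳ as p

range : ℕ → List ℕ
range n = map suc (upTo n)

range-unique : ∀ n → Unique (range n)
range-unique n = Unique.map⁺ suc-injective (Unique.upTo⁺ n)

∈-range⁺ : ∀ {n x} → 1 ≤ x → x ≤ n → x ∈ range n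
∈-range⁺ (s≤s _) x≤n = ∈-map⁺ suc (∈-upTo⁺ x≤n)

∈-range⁻ : ∀ {n x} → x ∈ range n → 1 ≤ x × x ≤ n
∈-range⁻ x∈ with ∈-map⁻ suc x∈
... | y , y∈ , refl = s≤s z≤n , ∈-upTo⁻ y∈

∈-words⁻ : ∀ n k {w} → w ∈ words n k → length w ≡ k × All (_∈ range n) w
∈-words⁻ n zero (here refl) = refl , []
∈-words⁻ n (suc k) w∈ with find (∈-concatMap⁻ (λ w → map (_∷ w) (range n)) {xs = words n k} w∈)
... | v , v∈ , w∈v with ∈-map⁻ (_∷ v) w∈v
... | x , x∈ , refl = let e , a = ∈-words⁻ n k v∈ in cong suc e , x∈ ∷ a

∈-words⁺ : ∀ n {w} → All (_∈ range n) w → w ∈ words n (length w)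
∈-words⁺ n [] = here refl
∈-words⁺ n {x ∷ w} (x∈ ∷ a) =
  ∈-concatMap⁺ (λ w → map (_∷ w) (range n)) (lose (∈-words⁺ n a) (∈-map⁺ (_∷ w) x∈))

words-unique : ∀ n k → Unique (words n k)
words-unique n zero = [] ∷ []
words-unique n (suc k) = unique-concatMap (λ w → map (_∷ w) (range n)) (words-unique n k)
  (All.tabulate λ _ → Unique.map⁺ (λ { refl → refl }) (range-unique n))
  λ {x} {y} _ _ z∈x z∈y → tails (∈-map⁻ (_∷ x) z∈x) (∈-map⁻ (_∷ y) z∈y)
  where
  tails : ∀ {x y z : List ℕ} → ∃ (λ a → a ∈ range n × z ≡ a ∷ x) →
          ∃ (λ a → a ∈ range n × z ≡ a ∷ y) → x ≡ y
  tails (_ , _ , refl) (_ , _ , refl) = refl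

perms-unique : ∀ n → Unique (perms n)
perms-unique n = Unique.filter⁺ unique? (words-unique n n)

∈-perms⁻ : ∀ n {w} → w ∈ perms n → length w ≡ n × All (_∈ range n) w × Unique w
∈-perms⁻ n w∈ with ∈-filter⁻ unique? {xs = words n n} w∈
... | w∈′ , u = let e , a = ∈-words⁻ n n w∈′ in e , a , u

∈-perms⁺ : ∀ n {w} → length w ≡ n → All (_∈ range n) w → Unique w → w ∈ perms n
∈-perms⁺ _ refl a u = ∈-filter⁺ unique? (∈-words⁺ _ a) u

insertAll : ℕ → List ℕ → List (List ℕ)
insertAll M []      = [ [ M ] ]
insertAll M (x ∷ w) = (M ∷ x ∷ w) ∷ map (x ∷_) (insertAll M w)

insertAll-↭ : ∀ M w {z} → z ∈ insertAll M w → z ↭ M ∷ w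
insertAll-↭ M [] (here refl) = ↭-refl
insertAll-↭ M (x ∷ w) (here refl) = ↭-refl
insertAll-↭ M (x ∷ w) (there z∈) with ∈-map⁻ (x ∷_) z∈
... | v , v∈ , refl = ↭-trans (prep x (insertAll-↭ M w v∈)) (swap x M ↭-refl)

∈-insertAll : ∀ M us {vs} → us ++ [ M ] ++ vs ∈ insertAll M (us ++ vs)
∈-insertAll M [] {[]} = here refl
∈-insertAll M [] {_ ∷ _} = here refl
∈-insertAll M (u ∷ us) = there (∈-map⁺ (u ∷_) (∈-insertAll M us))

insertAll-unique : ∀ M w → All (M ≢_) w → Unique (insertAll M w)
insertAll-unique M [] _ = [] ∷ []
insertAll-unique M (x ∷ w) (M≢x ∷ M∉w) =
  All.map⁺ (All.tabulate λ _ → λ { refl → M≢x refl })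
  ∷ Unique.map⁺ (λ { refl → refl }) (insertAll-unique M w M∉w)

-- Left inverse of insertion: the original word can be read off from any insertion of a fresh `M`,
-- so insertions into different words never coincide.
delete : ℕ → List ℕ → List ℕ
delete M = filter (λ x → ¬? (M ≟ x))

delete-insertAll : ∀ M w → All (M ≢_) w → ∀ {z} → z ∈ insertAll M w → delete M z ≡ w
delete-insertAll M [] _ (here refl) = filter-reject (λ x → ¬? (M ≟ x)) (λ M≢M → M≢M refl)
delete-insertAll M (x ∷ w) M∉ (here refl) =
  trans (filter-reject (λ x → ¬? (M ≟ x)) (λ M≢M → M≢M refl)) (filter-all (λ x → ¬? (M ≟ x)) M∉)
delete-insertAll M (x ∷ w) (M≢x ∷ M∉w) (there z∈) with ∈-map⁻ (x ∷_) z∈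
... | v , v∈ , refl = trans (filter-accept (λ x → ¬? (M ≟ x)) M≢x) (cong (x ∷_) (delete-insertAll M w M∉w v∈))

range-≢ : ∀ {n x} → x ∈ range n → suc n ≢ x
range-≢ x∈ refl = 1+n≰n (proj₂ (∈-range⁻ x∈))

range-suc : ∀ {n x} → x ∈ range n → x ∈ range (suc n)
range-suc x∈ = let p , q = ∈-range⁻ x∈ in ∈-range⁺ p (m≤n⇒m≤1+n q)

range-pred : ∀ {n x} → suc n ≢ x × x ∈ range (suc n) → x ∈ range n
range-pred (n≢x , x∈) = let p , q = ∈-range⁻ x∈ in ∈-range⁺ p (≤-pred (≤∧≢⇒< q (n≢x ∘ sym)))

-- Otherwise n + 1 distinct letters would fit into `range n`.
max∈perm : ∀ n {w} → w ∈ perms (suc n) → suc n ∈ w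
max∈perm n {w} w∈ with Any.any? (suc n ≟_) w | ∈-perms⁻ (suc n) w∈
... | yes p | _ = p
... | no M∉ | e , a , u = ⊥-elim (1+n≰n (begin
  suc n            ≡⟨ e ⟨
  length w         ≤⟨ unique-⊆-length u (All.zipWith range-pred (All.¬Any⇒All¬ w M∉ , a)) ⟩
  length (range n) ≡⟨ trans (length-map suc (upTo n)) (length-upTo n) ⟩
  n                ∎))
  where open ≤-Reasoning

-- Both lists are free of duplicates and have the same members, so they agree up to order, which is
-- enough for sums.
perms-suc : ∀ n → perms (suc n) ↭ concatMap (insertAll (suc n)) (perms n)
perms-suc n = ∼bag⇒↭ (unique∧set⇒bag (perms-unique (suc n)) insertions-unique (mk⇔ to from))
  where
  fresh : ∀ {w} → w ∈ perms n → All (suc n ≢_) w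
  fresh w∈ = All.map range-≢ (proj₁ (proj₂ (∈-perms⁻ n w∈)))

  insertions-unique : Unique (concatMap (insertAll (suc n)) (perms n))
  insertions-unique = unique-concatMap (insertAll (suc n)) (perms-unique n)
    (All.tabulate λ {w} w∈ → insertAll-unique (suc n) w (fresh w∈))
    λ {x} {y} x∈ y∈ z∈x z∈y → trans (sym (delete-insertAll (suc n) x (fresh x∈) z∈x))
                                    (delete-insertAll (suc n) y (fresh y∈) z∈y)

  to : ∀ {z} → z ∈ perms (suc n) → z ∈ concatMap (insertAll (suc n)) (perms n)
  to z∈ with ∈-∃++ (max∈perm n z∈) | ∈-perms⁻ (suc n) z∈
  ... | us , vs , refl | e , a , u
    -- Moving the maximum to the front carries distinctness, range and length over to the word
    -- without it.
    with Unique-resp-↭ (≡.setoid ℕ) (↭⇒↭ₛ (shift (suc n) us vs)) u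
       | All-resp-↭ (shift (suc n) us vs) a
       | trans (sym (↭-length (shift (suc n) us vs))) e
  ... | M∉ ∷ u′ | _ ∷ a′ | e′ = ∈-concatMap⁺ (insertAll (suc n))
    (lose (∈-perms⁺ n (suc-injective e′) (All.zipWith range-pred (M∉ , a′)) u′) (∈-insertAll (suc n) us))

  from : ∀ {z} → z ∈ concatMap (insertAll (suc n)) (perms n) → z ∈ perms (suc n)
  from z∈ with find (∈-concatMap⁻ (insertAll (suc n)) z∈)
  ... | w , w∈ , z∈w with ∈-perms⁻ n w∈ | ↭-sym (insertAll-↭ (suc n) w z∈w)
  ... | e , a , u | σ = ∈-perms⁺ (suc n)
    (trans (sym (↭-length σ)) (cong suc e))
    (All-resp-↭ σ (∈-range⁺ (s≤s z≤n) ≤-refl ∷ All.map range-suc a))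
    (Unique-resp-↭ (≡.setoid ℕ) (↭⇒↭ₛ σ) (fresh w∈ ∷ u))

-- Sums over lists and indicators

∑ : {A : Set} → (A → ℕ) → List A → ℕ
∑ f xs = sum (map f xs)

∑-cong : {A : Set} {f g : A → ℕ} (xs : List A) → (∀ {x} → x ∈ xs → f x ≡ g x) → ∑ f xs ≡ ∑ g xs
∑-cong []       f≡g = refl
∑-cong (x ∷ xs) f≡g = cong₂ _+_ (f≡g (here refl)) (∑-cong xs (f≡g ∘ there))

∑-map : {A B : Set} (f : B → ℕ) (g : A → B) (xs : List A) → ∑ f (map g xs) ≡ ∑ (f ∘ g) xs
∑-map f g xs = cong sum (sym (map-∘ xs))

∑-concatMap : {A B : Set} (f : B → ℕ) (g : A → List B) (xs : List A) →
  ∑ f (concatMap g xs) ≡ ∑ (∑ f ∘ g) xs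
∑-concatMap f g []       = refl
∑-concatMap f g (x ∷ xs) = begin
  sum (map f (g x ++ concatMap g xs))   ≡⟨ cong sum (map-++ f (g x) _) ⟩
  sum (map f (g x) ++ map f (concatMap g xs)) ≡⟨ sum-++ (map f (g x)) _ ⟩
  ∑ f (g x) + ∑ f (concatMap g xs)      ≡⟨ cong (_+_ (∑ f (g x))) (∑-concatMap f g xs) ⟩
  ∑ f (g x) + ∑ (∑ f ∘ g) xs            ∎
  where open ≡-Reasoning

∑-+ : {A : Set} (f g : A → ℕ) (xs : List A) → ∑ (λ x → f x + g x) xs ≡ ∑ f xs + ∑ g xs
∑-+ f g []       = refl
∑-+ f g (x ∷ xs) = trans (cong (_+_ (f x + g x)) (∑-+ f g xs))
  (solve 4 (λ a b c d → (a :+ b) :+ (c :+ d) := (a :+ c) :+ (b :+ d)) refl (f x) (g x) (∑ f xs) (∑ g xs))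
  where open +-*-Solver

∑-*ˡ : {A : Set} (c : ℕ) (f : A → ℕ) (xs : List A) → ∑ (λ x → c * f x) xs ≡ c * ∑ f xs
∑-*ˡ c f []       = sym (*-zeroʳ c)
∑-*ˡ c f (x ∷ xs) = trans (cong (_+_ (c * f x)) (∑-*ˡ c f xs)) (sym (*-distribˡ-+ c (f x) _))

∑-*ʳ : {A : Set} (c : ℕ) (f : A → ℕ) (xs : List A) → ∑ (λ x → f x * c) xs ≡ ∑ f xs * c
∑-*ʳ c f []       = refl
∑-*ʳ c f (x ∷ xs) = trans (cong (_+_ (f x * c)) (∑-*ʳ c f xs)) (sym (*-distribʳ-+ c (f x) _))

∑-0 : {A : Set} {f : A → ℕ} (xs : List A) → (∀ {x} → x ∈ xs → f x ≡ 0) → ∑ f xs ≡ 0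
∑-0 []       f≡0 = refl
∑-0 (x ∷ xs) f≡0 = cong₂ _+_ (f≡0 (here refl)) (∑-0 xs (f≡0 ∘ there))

ind : {P : Set} → Dec P → ℕ
ind P? = if does P? then 1 else 0

ind-yes : {P : Set} (P? : Dec P) → P → ind P? ≡ 1
ind-yes (yes _) p = refl
ind-yes (no ¬p) p = ⊥-elim (¬p p)

ind-no : {P : Set} (P? : Dec P) → ¬ P → ind P? ≡ 0
ind-no (yes p) ¬p = ⊥-elim (¬p p)
ind-no (no _)  ¬p = refl

length-filter≡∑ : {A : Set} {P : A → Set} (P? : ∀ x → Dec (P x)) (xs : List A) →
  length (filter P? xs) ≡ ∑ (ind ∘ P?) xs
length-filter≡∑ P? []       = refl
length-filter≡∑ P? (x ∷ xs) with P? x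
... | yes _ = cong suc (length-filter≡∑ P? xs)
... | no _  = length-filter≡∑ P? xs

-- Signatures

signature : List ℕ → List Bool
signature []          = []
signature (x ∷ [])    = []
signature (x ∷ y ∷ w) = (x <ᵇ y) ∷ signature (y ∷ w)

-- The signatures after inserting a maximum anywhere but in front.
insertMax⁺ : List Bool → List (List Bool)
insertMax⁺ []      = [ [ true ] ]
insertMax⁺ (x ∷ s) = (true ∷ false ∷ s) ∷ map (x ∷_) (insertMax⁺ s)

insertMax : List Bool → List (List Bool)
insertMax s = (false ∷ s) ∷ insertMax⁺ s

-- Indexed by the length of the signature: Sigs k belongs to the permutations of k + 1 letters.
Sigs : ℕ → List (List Bool)
Sigs zero    = [ [] ]
Sigs (suc k) = concatMap insertMax (Sigs k)

<⇒<ᵇ≡true : ∀ {m n} → m < n → (m <ᵇ n) ≡ true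
<⇒<ᵇ≡true {m} {n} m<n with m <ᵇ n | <⇒<ᵇ m<n
... | true | _ = refl

≤⇒<ᵇ≡false : ∀ {m n} → n ≤ m → (m <ᵇ n) ≡ false
≤⇒<ᵇ≡false {m} {n} n≤m with m <ᵇ n in eq
... | false = refl
... | true  = ⊥-elim (<⇒≱ (<ᵇ⇒< m n (subst T (sym eq) _)) n≤m)

signature-insertMax⁺ : ∀ M x w → All (_< M) (x ∷ w) → map (signature ∘ (x ∷_)) (insertAll M w) ≡ insertMax⁺ (signature (x ∷ w))
signature-insertMax⁺ M x [] (x<M ∷ []) = cong (λ b → [ [ b ] ]) (<⇒<ᵇ≡true x<M)
signature-insertMax⁺ M x (y ∷ w) (x<M ∷ y<M ∷ w<M) = cong₂ _∷_
  (cong₂ (λ b c → b ∷ c ∷ signature (y ∷ w)) (<⇒<ᵇ≡true x<M) (≤⇒<ᵇ≡false (<⇒≤ y<M)))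
  (begin
    map (signature ∘ (x ∷_)) (map (y ∷_) (insertAll M w))       ≡⟨ map-∘ (insertAll M w) ⟨
    map (((x <ᵇ y) ∷_) ∘ signature ∘ (y ∷_)) (insertAll M w)    ≡⟨ map-∘ (insertAll M w) ⟩
    map ((x <ᵇ y) ∷_) (map (signature ∘ (y ∷_)) (insertAll M w)) ≡⟨ cong (map ((x <ᵇ y) ∷_)) (signature-insertMax⁺ M y w (y<M ∷ w<M)) ⟩
    map ((x <ᵇ y) ∷_) (insertMax⁺ (signature (y ∷ w)))                ∎)
  where open ≡-Reasoning

signature-insertAll : ∀ M x w → All (_< M) (x ∷ w) → map signature (insertAll M (x ∷ w)) ≡ insertMax (signature (x ∷ w))
signature-insertAll M x w w<M@(x<M ∷ _) = cong₂ _∷_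
  (cong (_∷ signature (x ∷ w)) (≤⇒<ᵇ≡false (<⇒≤ x<M)))
  (trans (sym (map-∘ (insertAll M w))) (signature-insertMax⁺ M x w w<M))

-- The induction runs over all `F` at once: summing over the places of the maximum turns `F` into
-- `∑ F ∘ insertMax`, which again depends on the signature only.
∑-perms : ∀ k (F : List Bool → ℕ) → ∑ (F ∘ signature) (perms (suc k)) ≡ ∑ F (Sigs k)
∑-perms zero F = refl
∑-perms (suc k) F = begin
  ∑ (F ∘ signature) (perms (2 + k))                             ≡⟨ sum-↭ (↭-map⁺ (F ∘ signature) (perms-suc (suc k))) ⟩
  ∑ (F ∘ signature) (concatMap (insertAll (2 + k)) (perms (suc k))) ≡⟨ ∑-concatMap (F ∘ signature) (insertAll (2 + k)) (perms (suc k)) ⟩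
  ∑ (∑ (F ∘ signature) ∘ insertAll (2 + k)) (perms (suc k))     ≡⟨ ∑-cong (perms (suc k)) (λ {w} → step w) ⟩
  ∑ (∑ F ∘ insertMax ∘ signature) (perms (suc k))                     ≡⟨ ∑-perms k (∑ F ∘ insertMax) ⟩
  ∑ (∑ F ∘ insertMax) (Sigs k)                                     ≡⟨ ∑-concatMap F insertMax (Sigs k) ⟨
  ∑ F (Sigs (suc k))                                         ∎
  where
  open ≡-Reasoning
  step : ∀ w → w ∈ perms (suc k) → ∑ (F ∘ signature) (insertAll (2 + k) w) ≡ ∑ F (insertMax (signature w))
  step w w∈ with w | ∈-perms⁻ (suc k) w∈
  ... | x ∷ v | _ , a , _ = trans (cong sum (map-∘ (insertAll (2 + k) (x ∷ v))))
    (cong (∑ F) (signature-insertAll (2 + k) x v (All.map (s≤s ∘ proj₂ ∘ ∈-range⁻) a)))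

Sigs-length : ∀ k → All (λ s → length s ≡ k) (Sigs k)
Sigs-length zero = refl ∷ []
Sigs-length (suc k) = All.concat⁺ (All.map⁺ (All.map (λ {s} e → cong suc e ∷ All.map (λ p → trans p (cong suc e)) (insertMax⁺-length s)) (Sigs-length k)))
  where
  insertMax⁺-length : ∀ s → All (λ t → length t ≡ suc (length s)) (insertMax⁺ s)
  insertMax⁺-length [] = refl ∷ []
  insertMax⁺-length (x ∷ s) = refl ∷ All.map⁺ (All.map (cong suc) (insertMax⁺-length s))

-- In the second summand drop (suc a) s starts with the entry across the cut, or is empty if
-- nothing lies right of the cut; dropping the first entry after insertion covers both cases.
insertMax⁺-split : ∀ (A B : List Bool → ℕ) a s → a < length s →
  ∑ (λ t → A (take (suc a) t) * B (drop (2 + a) t)) (insertMax⁺ s)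
  ≡ ∑ A (insertMax⁺ (take a s)) * B (drop (suc a) s) + A (take (suc a) s) * ∑ B (map (drop 1) (insertMax⁺ (drop (suc a) s)))
insertMax⁺-split A B zero (x ∷ s) _ = cong₂ _+_
  (cong (_* B s) (sym (+-identityʳ (A [ true ]))))
  (begin
    ∑ (λ t → A (take 1 t) * B (drop 2 t)) (map (x ∷_) (insertMax⁺ s)) ≡⟨ ∑-map _ (x ∷_) (insertMax⁺ s) ⟩
    ∑ (λ t → A [ x ] * B (drop 1 t)) (insertMax⁺ s)                   ≡⟨ ∑-*ˡ (A [ x ]) (B ∘ drop 1) (insertMax⁺ s) ⟩
    A [ x ] * ∑ (B ∘ drop 1) (insertMax⁺ s)                           ≡⟨ cong (A [ x ] *_) (∑-map B (drop 1) (insertMax⁺ s)) ⟨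
    A [ x ] * ∑ B (map (drop 1) (insertMax⁺ s))                       ∎)
  where open ≡-Reasoning
insertMax⁺-split A B (suc a) (x ∷ s) (s≤s a<s) = begin
  p * q + ∑ (λ t → A (take (2 + a) t) * B (drop (3 + a) t)) (map (x ∷_) (insertMax⁺ s))
    ≡⟨ cong (_+_ (p * q)) (∑-map _ (x ∷_) (insertMax⁺ s)) ⟩
  p * q + ∑ (λ t → A (x ∷ take (suc a) t) * B (drop (2 + a) t)) (insertMax⁺ s)
    ≡⟨ cong (_+_ (p * q)) (insertMax⁺-split (A ∘ (x ∷_)) B a s a<s) ⟩
  p * q + (∑ (A ∘ (x ∷_)) (insertMax⁺ (take a s)) * q + r)
    ≡⟨ cong (λ z → p * q + (z * q + r)) (∑-map A (x ∷_) (insertMax⁺ (take a s))) ⟨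
  p * q + (∑ A (map (x ∷_) (insertMax⁺ (take a s))) * q + r)
    ≡⟨ +-assoc (p * q) _ r ⟨
  p * q + ∑ A (map (x ∷_) (insertMax⁺ (take a s))) * q + r
    ≡⟨ cong (_+ r) (*-distribʳ-+ q p _) ⟨
  (p + ∑ A (map (x ∷_) (insertMax⁺ (take a s)))) * q + r ∎
  where
  open ≡-Reasoning
  p q r : ℕ
  p = A (true ∷ false ∷ take a s)
  q = B (drop (suc a) s)
  r = A (x ∷ take (suc a) s) * ∑ B (map (drop 1) (insertMax⁺ (drop (suc a) s)))

-- Insertion in front leaves the part right of the cut alone, so it completes
-- `insertMax⁺ (take a s)` to `insertMax (take a s)`.
insertMax-split : ∀ (A B : List Bool → ℕ) a s → a < length s →
  ∑ (λ t → A (take (suc a) t) * B (drop (2 + a) t)) (insertMax s)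
  ≡ ∑ A (insertMax (take a s)) * B (drop (suc a) s) + A (take (suc a) s) * ∑ B (map (drop 1) (insertMax⁺ (drop (suc a) s)))
insertMax-split A B a s a<s = begin
  p * q + ∑ (λ t → A (take (suc a) t) * B (drop (2 + a) t)) (insertMax⁺ s) ≡⟨ cong (_+_ (p * q)) (insertMax⁺-split A B a s a<s) ⟩
  p * q + (∑ A (insertMax⁺ (take a s)) * q + r) ≡⟨ +-assoc (p * q) _ r ⟨
  p * q + ∑ A (insertMax⁺ (take a s)) * q + r ≡⟨ cong (_+ r) (*-distribʳ-+ q p _) ⟨
  (p + ∑ A (insertMax⁺ (take a s))) * q + r ∎
  where
  open ≡-Reasoning
  p q r : ℕ
  p = A (false ∷ take a s)
  q = B (drop (suc a) s)
  r = A (take (suc a) s) * ∑ B (map (drop 1) (insertMax⁺ (drop (suc a) s)))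

-- With a single letter left of the cut, the maximum is that letter exactly when it is inserted in
-- front.
insertMax-split₀ : ∀ (A B : List Bool → ℕ) s →
  ∑ (λ t → A (take 0 t) * B (drop 1 t)) (insertMax s)
  ≡ A [] * B s + A [] * ∑ B (map (drop 1) (insertMax⁺ s))
insertMax-split₀ A B s = cong (_+_ (A [] * B s))
  (trans (∑-*ˡ (A []) (B ∘ drop 1) (insertMax⁺ s)) (cong (A [] *_) (sym (∑-map B (drop 1) (insertMax⁺ s)))))

-- Here the inserted maximum is the only letter right of the cut.
tails-insertMax⁺-[] : ∀ (B : List Bool → ℕ) a s → length s ≡ a → ∑ B (map (drop 1) (insertMax⁺ (drop a s))) ≡ B []
tails-insertMax⁺-[] B zero [] e = +-identityʳ (B [])
tails-insertMax⁺-[] B (suc a) (x ∷ s) e = tails-insertMax⁺-[] B a s (suc-injective e)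

-- Once the entry across the cut is dropped, the maximum may stand anywhere in the right part, its
-- front included; hence `insertMax` and not `insertMax⁺`.
tails-insertMax⁺-∷ : ∀ (B : List Bool → ℕ) a s → a < length s →
  ∑ B (map (drop 1) (insertMax⁺ (drop a s))) ≡ ∑ B (insertMax (drop (suc a) s))
tails-insertMax⁺-∷ B zero (x ∷ s) _ = cong (λ z → B (false ∷ s) + ∑ B z) (trans (sym (map-∘ (insertMax⁺ s))) (map-id (insertMax⁺ s)))
tails-insertMax⁺-∷ B (suc a) (x ∷ s) (s≤s a<s) = tails-insertMax⁺-∷ B a s a<s

take-length : ∀ {a} (s : List Bool) → length s ≡ a → take a s ≡ s
take-length [] refl = refl
take-length (x ∷ s) refl = cong (x ∷_) (take-length s refl)

pascal : ∀ a b → suc (suc (a + b)) C suc b ≡ suc (a + b) C b + suc (a + b) C suc b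
pascal a b = sym (nCk+nC[k+1]≡[n+1]C[k+1] (suc (a + b)) b)

-- The binomial counts the choices of the b + 1 values right of the cut. Removing the maximum from
-- the left or right part shortens that part by one letter and replaces `A` by `∑ A ∘ insertMax` or
-- `B` by `∑ B ∘ insertMax`; the two contributions are added by Pascal's rule. `left` and `right`
-- call the lemma recursively on these smaller instances.
Sigs-split : ∀ (A B : List Bool → ℕ) a b →
  ∑ (λ s → A (take a s) * B (drop (suc a) s)) (Sigs (suc (a + b)))
  ≡ (suc (suc (a + b)) C suc b) * (∑ A (Sigs a) * ∑ B (Sigs b))
Sigs-split A B a b = begin
  ∑ (λ s → A (take a s) * B (drop (suc a) s)) (Sigs (suc (a + b)))
    ≡⟨ ∑-concatMap _ insertMax (Sigs (a + b)) ⟩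
  ∑ (λ s → ∑ (λ t → A (take a t) * B (drop (suc a) t)) (insertMax s)) (Sigs (a + b))
    ≡⟨ left A B a b ⟩
  (suc (a + b) C suc b) * X + ∑ (λ s → A (take a s) * ∑ B (map (drop 1) (insertMax⁺ (drop a s)))) (Sigs (a + b))
    ≡⟨ cong (_+_ ((suc (a + b) C suc b) * X)) (right A B a b) ⟩
  (suc (a + b) C suc b) * X + (suc (a + b) C b) * X
    ≡⟨ *-distribʳ-+ X (suc (a + b) C suc b) _ ⟨
  (suc (a + b) C suc b + suc (a + b) C b) * X
    ≡⟨ cong (_* X) (trans (+-comm (suc (a + b) C suc b) _) (sym (pascal a b))) ⟩
  (suc (suc (a + b)) C suc b) * X ∎
  where
  open ≡-Reasoning
  X = ∑ A (Sigs a) * ∑ B (Sigs b)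

  left : ∀ A B a b → ∑ (λ s → ∑ (λ t → A (take a t) * B (drop (suc a) t)) (insertMax s)) (Sigs (a + b))
    ≡ (suc (a + b) C suc b) * (∑ A (Sigs a) * ∑ B (Sigs b))
      + ∑ (λ s → A (take a s) * ∑ B (map (drop 1) (insertMax⁺ (drop a s)))) (Sigs (a + b))
  left A B zero b = begin
    ∑ (λ s → ∑ (λ t → A (take 0 t) * B (drop 1 t)) (insertMax s)) (Sigs b)
      ≡⟨ ∑-cong (Sigs b) (λ {s} _ → insertMax-split₀ A B s) ⟩
    ∑ (λ s → A [] * B s + A [] * ∑ B (map (drop 1) (insertMax⁺ s))) (Sigs b)
      ≡⟨ ∑-+ (λ s → A [] * B s) _ (Sigs b) ⟩
    ∑ (λ s → A [] * B s) (Sigs b) + R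
      ≡⟨ cong (_+ R) (∑-*ˡ (A []) B (Sigs b)) ⟩
    A [] * ∑ B (Sigs b) + R
      ≡⟨ cong (λ z → z * ∑ B (Sigs b) + R) (+-identityʳ (A [])) ⟨
    (A [] + 0) * ∑ B (Sigs b) + R
      ≡⟨ cong (_+ R) (*-identityˡ ((A [] + 0) * ∑ B (Sigs b))) ⟨
    1 * ((A [] + 0) * ∑ B (Sigs b)) + R
      ≡⟨ cong (λ z → z * ((A [] + 0) * ∑ B (Sigs b)) + R) (nCn≡1 (suc b)) ⟨
    (suc b C suc b) * ((A [] + 0) * ∑ B (Sigs b)) + R ∎
    where R = ∑ (λ s → A [] * ∑ B (map (drop 1) (insertMax⁺ s))) (Sigs b)
  left A B (suc a) b = begin
    ∑ (λ s → ∑ (λ t → A (take (suc a) t) * B (drop (2 + a) t)) (insertMax s)) (Sigs (suc (a + b)))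
      ≡⟨ ∑-cong (Sigs (suc (a + b))) (λ {s} s∈ → insertMax-split A B a s
           (subst (a <_) (sym (All.lookup (Sigs-length (suc (a + b))) s∈)) (s≤s (m≤m+n a b)))) ⟩
    ∑ (λ s → ∑ A (insertMax (take a s)) * B (drop (suc a) s) + A (take (suc a) s) * ∑ B (map (drop 1) (insertMax⁺ (drop (suc a) s)))) (Sigs (suc (a + b)))
      ≡⟨ ∑-+ (λ s → ∑ A (insertMax (take a s)) * B (drop (suc a) s)) _ (Sigs (suc (a + b))) ⟩
    ∑ (λ s → ∑ A (insertMax (take a s)) * B (drop (suc a) s)) (Sigs (suc (a + b))) + R
      ≡⟨ cong (_+ R) (Sigs-split (∑ A ∘ insertMax) B a b) ⟩
    (suc (suc (a + b)) C suc b) * (∑ (∑ A ∘ insertMax) (Sigs a) * ∑ B (Sigs b)) + R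
      ≡⟨ cong (λ z → (suc (suc (a + b)) C suc b) * (z * ∑ B (Sigs b)) + R) (∑-concatMap A insertMax (Sigs a)) ⟨
    (suc (suc (a + b)) C suc b) * (∑ A (Sigs (suc a)) * ∑ B (Sigs b)) + R ∎
    where R = ∑ (λ s → A (take (suc a) s) * ∑ B (map (drop 1) (insertMax⁺ (drop (suc a) s)))) (Sigs (suc (a + b)))

  right : ∀ A B a b → ∑ (λ s → A (take a s) * ∑ B (map (drop 1) (insertMax⁺ (drop a s)))) (Sigs (a + b))
    ≡ (suc (a + b) C b) * (∑ A (Sigs a) * ∑ B (Sigs b))
  right A B a zero rewrite +-identityʳ a = begin
    ∑ (λ s → A (take a s) * ∑ B (map (drop 1) (insertMax⁺ (drop a s)))) (Sigs a)
      ≡⟨ ∑-cong (Sigs a) (λ {s} s∈ → let e = All.lookup (Sigs-length a) s∈ in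
           cong₂ _*_ (cong A (take-length s e)) (tails-insertMax⁺-[] B a s e)) ⟩
    ∑ (λ s → A s * B []) (Sigs a)       ≡⟨ ∑-*ʳ (B []) A (Sigs a) ⟩
    ∑ A (Sigs a) * B []                 ≡⟨ cong (∑ A (Sigs a) *_) (+-identityʳ (B [])) ⟨
    ∑ A (Sigs a) * (B [] + 0)           ≡⟨ *-identityˡ _ ⟨
    1 * (∑ A (Sigs a) * (B [] + 0))     ∎
  right A B a (suc b) rewrite +-suc a b = begin
    ∑ (λ s → A (take a s) * ∑ B (map (drop 1) (insertMax⁺ (drop a s)))) (Sigs (suc (a + b)))
      ≡⟨ ∑-cong (Sigs (suc (a + b))) (λ {s} s∈ → cong (A (take a s) *_) (tails-insertMax⁺-∷ B a s
           (subst (a <_) (sym (All.lookup (Sigs-length (suc (a + b))) s∈)) (s≤s (m≤m+n a b))))) ⟩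
    ∑ (λ s → A (take a s) * ∑ B (insertMax (drop (suc a) s))) (Sigs (suc (a + b)))
      ≡⟨ Sigs-split A (∑ B ∘ insertMax) a b ⟩
    (suc (suc (a + b)) C suc b) * (∑ A (Sigs a) * ∑ (∑ B ∘ insertMax) (Sigs b))
      ≡⟨ cong (λ z → (suc (suc (a + b)) C suc b) * (∑ A (Sigs a) * z)) (∑-concatMap B insertMax (Sigs b)) ⟨
    (suc (suc (a + b)) C suc b) * (∑ A (Sigs a) * ∑ B (Sigs (suc b))) ∎

-- Peaks of signatures

-- Entry i of a signature compares letters i and i + 1, so an ascent followed by a descent at the
-- front makes letter 2 a peak; removing the first letter shifts all positions by one.
pk : List Bool → List ℕ
pk []                 = []
pk (false ∷ s)        = map suc (pk s)
pk (true ∷ [])        = []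
pk (true ∷ true ∷ s)  = map suc (pk (true ∷ s))
pk (true ∷ false ∷ s) = 2 ∷ map suc (pk (false ∷ s))

filterᵇ-applyUpTo-suc : ∀ (p q : ℕ → Bool) (f : ℕ → ℕ) k → (∀ i → p (suc (f i)) ≡ q (f i)) →
  filterᵇ p (applyUpTo (suc ∘ f) k) ≡ map suc (filterᵇ q (applyUpTo f k))
filterᵇ-applyUpTo-suc p q f zero    p≡q = refl
filterᵇ-applyUpTo-suc p q f (suc k) p≡q rewrite p≡q 0 with q (f 0)
... | true  = cong (suc (f 0) ∷_) (filterᵇ-applyUpTo-suc p q (f ∘ suc) k (p≡q ∘ suc))
... | false = filterᵇ-applyUpTo-suc p q (f ∘ suc) k (p≡q ∘ suc)

filterᵇ-∷ : ∀ (p : ℕ → Bool) x xs →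
  filterᵇ p (x ∷ xs) ≡ (if p x then x ∷ filterᵇ p xs else filterᵇ p xs)
filterᵇ-∷ p x xs with p x
... | true  = refl
... | false = refl

pk-∷ : ∀ b c s → pk (b ∷ c ∷ s) ≡ (if b ∧ not c then 2 ∷ map suc (pk (c ∷ s)) else map suc (pk (c ∷ s)))
pk-∷ false c s    = refl
pk-∷ true true s  = refl
pk-∷ true false s = refl

<ᵇ-flip : ∀ {m n} → m ≢ n → (n <ᵇ m) ≡ not (m <ᵇ n)
<ᵇ-flip {m} {n} m≢n with <-cmp m n
... | tri< m<n _ _ = trans (≤⇒<ᵇ≡false (<⇒≤ m<n)) (cong not (sym (<⇒<ᵇ≡true m<n)))
... | tri≈ _ m≡n _ = ⊥-elim (m≢n m≡n)
... | tri> _ _ n<m = trans (<⇒<ᵇ≡true n<m) (cong not (sym (≤⇒<ᵇ≡false (<⇒≤ n<m))))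

-- Distinctness of the letters makes the second comparison in `isPeak` the negation of the next
-- entry of the signature.
peaks≡pk : ∀ w → Unique w → peaks w ≡ pk (signature w)
peaks≡pk [] _ = refl
peaks≡pk (x ∷ []) _ = refl
peaks≡pk (x ∷ y ∷ []) _ with x <ᵇ y
... | true  = refl
... | false = refl
peaks≡pk (x ∷ y ∷ z ∷ w) (_ ∷ u@((y≢z ∷ _) ∷ _)) = begin
  -- Positions 0 and 1 fail the test by computation, so the filtering starts at 2.
  filterᵇ p (2 ∷ later)                            ≡⟨ filterᵇ-∷ p 2 later ⟩
  (if p 2 then 2 ∷ filterᵇ p later else filterᵇ p later)
    ≡⟨ cong₂ (λ b ys → if b then 2 ∷ ys else ys) (cong ((x <ᵇ y) ∧_) (<ᵇ-flip y≢z)) (tail (peaks≡pk (y ∷ z ∷ w) u)) ⟩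
  (if (x <ᵇ y) ∧ not (y <ᵇ z) then 2 ∷ map suc q else map suc q)
    ≡⟨ pk-∷ (x <ᵇ y) (y <ᵇ z) (signature (z ∷ w)) ⟨
  pk ((x <ᵇ y) ∷ (y <ᵇ z) ∷ signature (z ∷ w))           ∎
  where
  open ≡-Reasoning
  p : ℕ → Bool
  p = isPeak (x ∷ y ∷ z ∷ w)
  later q : List ℕ
  later = applyUpTo (_+_ 3) (suc (length w))
  q = pk (signature (y ∷ z ∷ w))
  tail : peaks (y ∷ z ∷ w) ≡ q → filterᵇ p later ≡ map suc q
  tail e = trans (filterᵇ-applyUpTo-suc p (isPeak (y ∷ z ∷ w)) (_+_ 2) (suc (length w)) (λ _ → refl))
                 (cong (map suc) e)

pk-≥2 : ∀ s → All (2 ≤_) (pk s)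
pk-≥2 []                 = []
pk-≥2 (false ∷ s)        = All.map⁺ (All.map m≤n⇒m≤1+n (pk-≥2 s))
pk-≥2 (true ∷ [])        = []
pk-≥2 (true ∷ true ∷ s)  = All.map⁺ (All.map m≤n⇒m≤1+n (pk-≥2 (true ∷ s)))
pk-≥2 (true ∷ false ∷ s) = ≤-refl ∷ All.map⁺ (All.map m≤n⇒m≤1+n (pk-≥2 (false ∷ s)))

pk-≤length : ∀ s → All (_≤ length s) (pk s)
pk-≤length []                 = []
pk-≤length (false ∷ s)        = All.map⁺ (All.map s≤s (pk-≤length s))
pk-≤length (true ∷ [])        = []
pk-≤length (true ∷ true ∷ s)  = All.map⁺ (All.map s≤s (pk-≤length (true ∷ s)))
pk-≤length (true ∷ false ∷ s) = s≤s (s≤s z≤n) ∷ All.map⁺ (All.map s≤s (pk-≤length (false ∷ s)))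

-- If letter 2 is a peak, the next peak is at least 4: the peaks of what follows the descent are at
-- least 2 by `pk-≥2`, and they are shifted twice.
pk-no-adjacent : ∀ s {l xs} → pk s ≢ l ∷ suc l ∷ xs
pk-no-adjacent (false ∷ s) e with pk s in eq
pk-no-adjacent (false ∷ s) refl | _ ∷ _ ∷ _ = pk-no-adjacent s eq
pk-no-adjacent (true ∷ true ∷ s) e with pk (true ∷ s) in eq
pk-no-adjacent (true ∷ true ∷ s) refl | _ ∷ _ ∷ _ = pk-no-adjacent (true ∷ s) eq
pk-no-adjacent (true ∷ false ∷ s) e with pk s | pk-≥2 s
pk-no-adjacent (true ∷ false ∷ s) () | zero ∷ _ | _
pk-no-adjacent (true ∷ false ∷ s) refl | suc zero ∷ _ | s≤s () ∷ _

-- X lists the peaks beyond a when a word with relative peaks R follows the first a letters: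
-- at most one of the two letters next to the cut can become a peak.
data Crossing (a : ℕ) (R : List ℕ) : List ℕ → Set where
  none  : Crossing a R (map (_+_ a) R)
  left  : Crossing a R (a ∷ map (_+_ a) R)
  right : Crossing a R (suc a ∷ map (_+_ a) R)

Crossing-suc : ∀ {a R X} → Crossing a R X → Crossing (suc a) R (map suc X)
Crossing-suc {a} {R} none  = subst (Crossing (suc a) R) (map-∘ R) none
Crossing-suc {a} {R} left  = subst (λ z → Crossing (suc a) R (suc a ∷ z)) (map-∘ R) left
Crossing-suc {a} {R} right = subst (λ z → Crossing (suc a) R (2 + a ∷ z)) (map-∘ R) right

private
  prepend : ∀ {a R Y} P → (∃ λ X → Y ≡ P ++ X × Crossing a R X) →
    ∃ λ X → map suc Y ≡ map suc P ++ X × Crossing (suc a) R X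
  prepend P (X , refl , c) = map suc X , map-++ suc P X , Crossing-suc c

-- `x` compares the two letters next to the cut. A descent can turn only the left one into a peak,
-- an ascent only the right one, and all peaks inside either part survive.
pk-++ : ∀ s x t → ∃ λ X → pk (s ++ x ∷ t) ≡ pk s ++ X × Crossing (suc (length s)) (pk t) X
pk-++ [] false t = _ , refl , none
pk-++ [] true [] = _ , refl , none
pk-++ [] true (true ∷ t) = _ , refl , none
pk-++ [] true (false ∷ t) = _ , refl , right
pk-++ (false ∷ s) x t = prepend (pk s) (pk-++ s x t)
pk-++ (true ∷ []) true t = prepend [] (pk-++ [] true t)
pk-++ (true ∷ []) false t = _ , cong (2 ∷_) (sym (map-∘ (pk t))) , left
pk-++ (true ∷ true ∷ s) x t = prepend (pk (true ∷ s)) (pk-++ (true ∷ s) x t)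
pk-++ (true ∷ false ∷ s) x t with prepend (pk (false ∷ s)) (pk-++ (false ∷ s) x t)
... | X , e , c = X , cong (2 ∷_) e , c

-- The threshold `a` will be the last position left of the cut. It separates the old peaks of the
-- left part from the others, so the two lists can be compared independently.
++-threshold-injective : ∀ {a} P S {X Y} → All (_< a) P → All (_< a) S → All (a ≤_) X → All (a ≤_) Y →
  P ++ X ≡ S ++ Y → P ≡ S × X ≡ Y
++-threshold-injective [] [] _ _ _ _ e = refl , e
++-threshold-injective [] (_ ∷ _) _ (s<a ∷ _) (a≤s ∷ _) _ refl = ⊥-elim (<⇒≱ s<a a≤s)
++-threshold-injective (_ ∷ _) [] (p<a ∷ _) _ _ (a≤p ∷ _) refl = ⊥-elim (<⇒≱ p<a a≤p)
++-threshold-injective (p ∷ P) (_ ∷ S) (_ ∷ P<a) (_ ∷ S<a) a≤X a≤Y e with ∷-injective e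
... | refl , e′ with ++-threshold-injective P S P<a S<a a≤X a≤Y e′
... | refl , X≡Y = refl , X≡Y

infix 4 _≟ₗ_
_≟ₗ_ : (xs ys : List ℕ) → Dec (xs ≡ ys)
_≟ₗ_ = ≡-dec _≟_

crossing-≥ : ∀ {a R X} → Crossing a R X → All (a ≤_) X
crossing-≥ {a} {R} none  = All.map⁺ (All.tabulate λ _ → m≤m+n a _)
crossing-≥ {a} {R} left  = ≤-refl ∷ crossing-≥ {a} {R} none
crossing-≥ {a} {R} right = n≤1+n a ∷ crossing-≥ {a} {R} none

-- For empty `R` the three shapes of a crossing are the three lists tested. For nonempty `R` the
-- entries are at least 2, so `X` contains a position beyond a + 1 and every test fails.
crossing-count : ∀ {a R X} → All (2 ≤_) R → Crossing a R X →
  ind (R ≟ₗ []) ≡ ind (X ≟ₗ []) + (ind (X ≟ₗ [ a ]) + ind (X ≟ₗ [ suc a ]))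
crossing-count {a} [] none = refl
crossing-count {a} [] left = sym (cong₂ _+_ (ind-yes ([ a ] ≟ₗ [ a ]) refl) (ind-no ([ a ] ≟ₗ [ suc a ]) λ ()))
crossing-count {a} [] right = sym (cong₂ _+_ (ind-no ([ suc a ] ≟ₗ [ a ]) λ ()) (ind-yes ([ suc a ] ≟ₗ [ suc a ]) refl))
crossing-count {a} {r ∷ R} (2≤r ∷ _) none = sym (cong₂ _+_
  (ind-no (map (_+_ a) (r ∷ R) ≟ₗ [ a ]) λ e → <⇒≢ (≤-trans (n≤1+n _) bound) (sym (∷-injectiveˡ e)))
  (ind-no (map (_+_ a) (r ∷ R) ≟ₗ [ suc a ]) λ e → <⇒≢ bound (sym (∷-injectiveˡ e))))
  where
  bound : suc a < a + r
  bound = subst (_≤ a + r) (+-comm a 2) (+-monoʳ-≤ a 2≤r)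
crossing-count {a} {r ∷ R} _ left = sym (cong₂ _+_
  (ind-no (a ∷ map (_+_ a) (r ∷ R) ≟ₗ [ a ]) λ ()) (ind-no (a ∷ map (_+_ a) (r ∷ R) ≟ₗ [ suc a ]) λ ()))
crossing-count {a} {r ∷ R} _ right = sym (cong₂ _+_
  (ind-no (suc a ∷ map (_+_ a) (r ∷ R) ≟ₗ [ a ]) λ ()) (ind-no (suc a ∷ map (_+_ a) (r ∷ R) ≟ₗ [ suc a ]) λ ()))

pk-split-count : ∀ s x t S → All (_< suc (length s)) S →
  let a = suc (length s) ; p = pk (s ++ x ∷ t) in
  ind (pk s ≟ₗ S) * ind (pk t ≟ₗ [])
  ≡ ind (p ≟ₗ S) + (ind (p ≟ₗ S ++ [ a ]) + ind (p ≟ₗ S ++ [ suc a ]))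
pk-split-count s x t S S<a with pk-++ s x t
... | X , e , c = begin
  i * ind (pk t ≟ₗ [])
    ≡⟨ cong (i *_) (crossing-count (pk-≥2 t) c) ⟩
  i * (ind (X ≟ₗ []) + (ind (X ≟ₗ [ a ]) + ind (X ≟ₗ [ suc a ])))
    ≡⟨ solve 4 (λ i u v w → i :* (u :+ (v :+ w)) := i :* u :+ (i :* v :+ i :* w)) refl i (ind (X ≟ₗ [])) (ind (X ≟ₗ [ a ])) (ind (X ≟ₗ [ suc a ])) ⟩
  i * ind (X ≟ₗ []) + (i * ind (X ≟ₗ [ a ]) + i * ind (X ≟ₗ [ suc a ]))
    ≡⟨ cong₂ _+_ (factor [] []) (cong₂ _+_ (factor [ a ] (≤-refl ∷ [])) (factor [ suc a ] (n≤1+n a ∷ []))) ⟩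
  ind (p ≟ₗ S ++ []) + (ind (p ≟ₗ S ++ [ a ]) + ind (p ≟ₗ S ++ [ suc a ]))
    ≡⟨ cong (λ z → ind (p ≟ₗ z) + (ind (p ≟ₗ S ++ [ a ]) + ind (p ≟ₗ S ++ [ suc a ]))) (++-identityʳ S) ⟩
  ind (p ≟ₗ S) + (ind (p ≟ₗ S ++ [ a ]) + ind (p ≟ₗ S ++ [ suc a ])) ∎
  where
  open ≡-Reasoning
  open +-*-Solver
  a = suc (length s)
  p = pk (s ++ x ∷ t)
  i = ind (pk s ≟ₗ S)
  factor : ∀ Y → All (a ≤_) Y → i * ind (X ≟ₗ Y) ≡ ind (p ≟ₗ S ++ Y)
  factor Y a≤Y with pk s ≟ₗ S | X ≟ₗ Y
  ... | yes refl | yes refl = sym (ind-yes (p ≟ₗ S ++ Y) e)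
  ... | yes refl | no X≢Y   = sym (ind-no (p ≟ₗ S ++ Y) λ e′ → X≢Y (++-cancelˡ S X Y (trans (sym e) e′)))
  ... | no s≢S   | _        = sym (ind-no (p ≟ₗ S ++ Y) λ e′ → s≢S (proj₁
    (++-threshold-injective (pk s) S (All.map s≤s (pk-≤length s)) S<a (crossing-≥ c) a≤Y (trans (sym e) e′))))

-- N S k is the number of permutations of {1, …, k + 1} with peak set S.
N : List ℕ → ℕ → ℕ
N S k = ∑ (λ s → ind (pk s ≟ₗ S)) (Sigs k)

countP≡N : ∀ l m k → countP l m (suc k) ≡ N (l ∷ m ∷ []) k
countP≡N l m k = begin
  countP l m (suc k)
    ≡⟨ length-filter≡∑ (λ w → peaks w ≟ₗ l ∷ m ∷ []) (perms (suc k)) ⟩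
  ∑ (λ w → ind (peaks w ≟ₗ l ∷ m ∷ [])) (perms (suc k))
    ≡⟨ ∑-cong (perms (suc k)) (λ {w} w∈ → cong (λ z → ind (z ≟ₗ l ∷ m ∷ []))
         (peaks≡pk w (proj₂ (proj₂ (∈-perms⁻ (suc k) w∈))))) ⟩
  ∑ (λ w → ind (pk (signature w) ≟ₗ l ∷ m ∷ [])) (perms (suc k))
    ≡⟨ ∑-perms k (λ s → ind (pk s ≟ₗ l ∷ m ∷ [])) ⟩
  N (l ∷ m ∷ []) k ∎
  where open ≡-Reasoning

split-at : ∀ a (s : List Bool) → a < length s → ∃ λ x → s ≡ take a s ++ x ∷ drop (suc a) s
split-at zero (x ∷ s) _ = x , refl
split-at (suc a) (y ∷ s) (s≤s a<s) with split-at a s a<s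
... | x , e = x , cong (y ∷_) e

-- This is `Sigs-split` for the tests "peak set `S`" and "no peaks". The left part has a + 1
-- letters, so the positions next to the cut are a + 1 and a + 2.
N-recurrence : ∀ a b S → All (_< suc a) S →
  (suc (suc (a + b)) C suc b) * (N S a * N [] b)
  ≡ N S (suc (a + b)) + (N (S ++ [ suc a ]) (suc (a + b)) + N (S ++ [ suc (suc a) ]) (suc (a + b)))
N-recurrence a b S S<a = begin
  (suc (suc (a + b)) C suc b) * (N S a * N [] b)
    ≡⟨ Sigs-split (λ s → ind (pk s ≟ₗ S)) (λ s → ind (pk s ≟ₗ [])) a b ⟨
  ∑ (λ s → ind (pk (take a s) ≟ₗ S) * ind (pk (drop (suc a) s) ≟ₗ [])) (Sigs k)
    ≡⟨ ∑-cong (Sigs k) (λ {s} s∈ → step s (All.lookup (Sigs-length k) s∈)) ⟩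
  ∑ (λ s → ind (pk s ≟ₗ S) + (ind (pk s ≟ₗ S ++ [ suc a ]) + ind (pk s ≟ₗ S ++ [ suc (suc a) ]))) (Sigs k)
    ≡⟨ ∑-+ (λ s → ind (pk s ≟ₗ S)) _ (Sigs k) ⟩
  N S k + ∑ (λ s → ind (pk s ≟ₗ S ++ [ suc a ]) + ind (pk s ≟ₗ S ++ [ suc (suc a) ])) (Sigs k)
    ≡⟨ cong (_+_ (N S k)) (∑-+ (λ s → ind (pk s ≟ₗ S ++ [ suc a ])) _ (Sigs k)) ⟩
  N S k + (N (S ++ [ suc a ]) k + N (S ++ [ suc (suc a) ]) k) ∎
  where
  open ≡-Reasoning
  k = suc (a + b)
  step : ∀ s → length s ≡ k →
    ind (pk (take a s) ≟ₗ S) * ind (pk (drop (suc a) s) ≟ₗ [])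
    ≡ ind (pk s ≟ₗ S) + (ind (pk s ≟ₗ S ++ [ suc a ]) + ind (pk s ≟ₗ S ++ [ suc (suc a) ]))
  step s e with split-at a s (subst (a <_) (sym e) (s≤s (m≤m+n a b)))
  ... | x , eq with pk-split-count (take a s) x (drop (suc a) s) S
  -- `count` measures the cut by the length of `take a s`; the rewrites identify that length with
  -- `a`.
  ... | count rewrite sym eq | length-take a s | e | m≤n⇒m⊓n≡m (m≤n⇒m≤1+n (m≤m+n a b)) = count S<a

N-one : ∀ k → N [ 1 ] k ≡ 0
N-one k = ∑-0 (Sigs k) λ {s} _ → ind-no (pk s ≟ₗ [ 1 ]) λ e → 1+n≰n (All.head (subst (All (2 ≤_)) e (pk-≥2 s)))

N-adjacent : ∀ l k → N (l ∷ suc l ∷ []) k ≡ 0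
N-adjacent l k = ∑-0 (Sigs k) λ {s} _ → ind-no (pk s ≟ₗ l ∷ suc l ∷ []) (pk-no-adjacent s)

N-last : ∀ l k → N (l ∷ suc k ∷ []) k ≡ 0
N-last l k = ∑-0 (Sigs k) λ {s} s∈ → ind-no (pk s ≟ₗ l ∷ suc k ∷ []) λ e →
  1+n≰n (subst (suc k ≤_) (All.lookup (Sigs-length k) s∈) (All.head (All.tail (subst (All (_≤ length s)) e (pk-≤length s)))))

-- Counting permutations without peaks.

ind-map-suc : ∀ xs → ind (map suc xs ≟ₗ []) ≡ ind (xs ≟ₗ [])
ind-map-suc []      = refl
ind-map-suc (_ ∷ _) = refl

peakless : List Bool → ℕ
peakless s = ind (pk s ≟ₗ [])

-- After a leading ascent only a word of ascents is peakless, and only a maximum at the very end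
-- keeps it so. The ascent is carried along because `pk` inspects two entries at a time.
peakless-true-insertMax⁺ : ∀ s → ∑ (peakless ∘ (true ∷_)) (insertMax⁺ s) ≡ peakless (true ∷ s)
peakless-true-insertMax⁺ [] = refl
peakless-true-insertMax⁺ (false ∷ s) = ∑-0 (map (false ∷_) (insertMax⁺ s)) (λ t∈ → zero-at (∈-map⁻ (false ∷_) t∈))
  where
  zero-at : ∀ {t} → ∃ (λ u → u ∈ insertMax⁺ s × t ≡ false ∷ u) → peakless (true ∷ t) ≡ 0
  zero-at (_ , _ , refl) = refl
peakless-true-insertMax⁺ (true ∷ s) = begin
  ∑ (peakless ∘ (true ∷_)) (map (true ∷_) (insertMax⁺ s)) ≡⟨ ∑-map _ (true ∷_) (insertMax⁺ s) ⟩
  ∑ (λ t → peakless (true ∷ true ∷ t)) (insertMax⁺ s)     ≡⟨ ∑-cong (insertMax⁺ s) (λ {t} _ → ind-map-suc (pk (true ∷ t))) ⟩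
  ∑ (λ t → peakless (true ∷ t)) (insertMax⁺ s)            ≡⟨ peakless-true-insertMax⁺ s ⟩
  peakless (true ∷ s)                               ≡⟨ ind-map-suc (pk (true ∷ s)) ⟨
  peakless (true ∷ true ∷ s)                        ∎
  where open ≡-Reasoning

-- A maximum that is neither first nor last is a peak, while a maximum at the end changes no peak.
peakless-insertMax⁺ : ∀ s → ∑ peakless (insertMax⁺ s) ≡ peakless s
peakless-insertMax⁺ [] = refl
peakless-insertMax⁺ (true ∷ s) = trans (∑-map peakless (true ∷_) (insertMax⁺ s)) (peakless-true-insertMax⁺ s)
peakless-insertMax⁺ (false ∷ s) = begin
  ∑ peakless (map (false ∷_) (insertMax⁺ s))   ≡⟨ ∑-map peakless (false ∷_) (insertMax⁺ s) ⟩
  ∑ (peakless ∘ (false ∷_)) (insertMax⁺ s)     ≡⟨ ∑-cong (insertMax⁺ s) (λ {t} _ → ind-map-suc (pk t)) ⟩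
  ∑ peakless (insertMax⁺ s)                    ≡⟨ peakless-insertMax⁺ s ⟩
  peakless s                             ≡⟨ ind-map-suc (pk s) ⟨
  peakless (false ∷ s)                   ∎
  where open ≡-Reasoning

-- The maximum must be placed first or last, so the count doubles with each new letter.
N-[] : ∀ k → N [] k ≡ 2 ^ k
N-[] zero = refl
N-[] (suc k) = begin
  ∑ peakless (concatMap insertMax (Sigs k)) ≡⟨ ∑-concatMap peakless insertMax (Sigs k) ⟩
  ∑ (∑ peakless ∘ insertMax) (Sigs k)       ≡⟨ ∑-cong (Sigs k) (λ {s} _ → cong₂ _+_ (ind-map-suc (pk s)) (trans (peakless-insertMax⁺ s) (sym (+-identityʳ _)))) ⟩
  ∑ (λ s → 2 * peakless s) (Sigs k)   ≡⟨ ∑-*ˡ 2 peakless (Sigs k) ⟩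
  2 * N [] k                       ≡⟨ cong (2 *_) (N-[] k) ⟩
  2 ^ suc k                        ∎
  where open ≡-Reasoning

-- Closed forms for one and two peaks

C-sym : ∀ a b → (a + b) C a ≡ (a + b) C b
C-sym a b = trans (nCk≡nC[n∸k] (m≤m+n a b)) (cong ((a + b) C_) (m+n∸m≡n a b))

pos-C-pascal : ∀ n k → + (suc n C suc k) ≡ + (n C k) ℤ.+ + (n C suc k)
pos-C-pascal n k = cong +_ (sym (nCk+nC[k+1]≡[n+1]C[k+1] n k))

-- Induction on the peak position with the size fixed: the recurrence for empty `S` ties the counts
-- for the neighbouring positions l + 1 and l + 2 together. The form without subtraction keeps the
-- argument in the natural numbers.
N-single : ∀ l e → 2 * N [ suc l ] (l + e) + 2 ^ (l + e) ≡ 2 ^ (l + e) * ((l + e) C e)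
N-single zero e = begin
  2 * N [ 1 ] e + 2 ^ e   ≡⟨ cong (λ z → 2 * z + 2 ^ e) (N-one e) ⟩
  2 ^ e                   ≡⟨ *-identityʳ (2 ^ e) ⟨
  2 ^ e * 1               ≡⟨ cong (2 ^ e *_) (nCn≡1 e) ⟨
  2 ^ e * (e C e)         ∎
  where open ≡-Reasoning
-- The summand added to both sides is the right side of `ih`, so the count for position l + 1 can be
-- brought in by addition.
N-single (suc l) e = +-cancelʳ-≡ (p * (k C suc e)) _ _ (begin
  2 * N [ 2 + l ] k + p + p * (k C suc e)
    ≡⟨ cong (λ z → 2 * N [ 2 + l ] k + p + z) ih ⟨
  2 * N [ 2 + l ] k + p + (2 * N [ suc l ] k + p)
    ≡⟨ solve 3 (λ x y p → con 2 :* x :+ p :+ (con 2 :* y :+ p) := con 2 :* (p :+ (y :+ x))) refl (N [ 2 + l ] k) (N [ suc l ] k) p ⟩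
  2 * (p + (N [ suc l ] k + N [ 2 + l ] k))
    ≡⟨ cong (λ z → 2 * (z + (N [ suc l ] k + N [ 2 + l ] k))) (N-[] k) ⟨
  2 * (N [] k + (N [ suc l ] k + N [ 2 + l ] k))
    ≡⟨ cong (2 *_) (N-recurrence l e [] []) ⟨
  2 * ((suc k C suc e) * (N [] l * N [] e))
    ≡⟨ cong (λ z → 2 * ((suc k C suc e) * z)) (trans (cong₂ _*_ (N-[] l) (N-[] e)) (sym (^-distribˡ-+-* 2 l e))) ⟩
  2 * ((suc k C suc e) * 2 ^ (l + e))
    ≡⟨ cong (λ z → 2 * (z * 2 ^ (l + e))) (nCk+nC[k+1]≡[n+1]C[k+1] k e) ⟨
  2 * ((k C e + k C suc e) * 2 ^ (l + e))
    ≡⟨ solve 3 (λ x y q → con 2 :* ((x :+ y) :* q) := con 2 :* q :* x :+ con 2 :* q :* y) refl (k C e) (k C suc e) (2 ^ (l + e)) ⟩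
  p * (k C e) + p * (k C suc e) ∎)
  where
  open ≡-Reasoning
  open +-*-Solver
  k = suc (l + e)
  p = 2 ^ k
  ih : 2 * N [ suc l ] k + p ≡ p * (k C suc e)
  ih = subst (λ j → 2 * N [ suc l ] j + 2 ^ j ≡ 2 ^ j * (j C suc e)) (+-suc l e) (N-single l (suc e))

N-singleℤ : ∀ l e → + 2 ℤ.* + N [ suc l ] (l + e) ≡ + (2 ^ (l + e)) ℤ.* (+ ((l + e) C l) ℤ.- + 1)
N-singleℤ l e = begin
  + 2 ℤ.* + n                     ≡⟨ solve 2 (λ n p → con (+ 2) :* n := con (+ 2) :* n :+ p :- p) refl (+ n) (+ p) ⟩
  + 2 ℤ.* + n ℤ.+ + p ℤ.- + p     ≡⟨ cong (λ z → z ℤ.+ + p ℤ.- + p) (ℤ.pos-* 2 n) ⟨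
  + (2 * n + p) ℤ.- + p           ≡⟨ cong (λ z → + z ℤ.- + p) (N-single l e) ⟩
  + (p * ((l + e) C e)) ℤ.- + p   ≡⟨ cong (λ z → + (p * z) ℤ.- + p) (C-sym l e) ⟨
  + (p * ((l + e) C l)) ℤ.- + p   ≡⟨ cong (ℤ._- + p) (ℤ.pos-* p _) ⟩
  + p ℤ.* + ((l + e) C l) ℤ.- + p ≡⟨ solve 2 (λ c p → p :* c :- p := p :* (c :- con (+ 1))) refl (+ ((l + e) C l)) (+ p) ⟩
  + p ℤ.* (+ ((l + e) C l) ℤ.- + 1) ∎
  where
  open ≡-Reasoning
  open ℤ.+-*-Solver
  n = N [ suc l ] (l + e)
  p = 2 ^ (l + e)

Σ<-cong : ∀ K {f g : ℕ → ℤ} → (∀ {k} → k < K → f k ≡ g k) → Σ< K f ≡ Σ< K g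
Σ<-cong zero    f≡g = refl
Σ<-cong (suc K) f≡g = cong₂ ℤ._+_ (f≡g (s≤s z≤n)) (Σ<-cong K (f≡g ∘ s≤s))

Σ<-*ˡ : ∀ K c (f : ℕ → ℤ) → Σ< K (λ k → c ℤ.* f k) ≡ c ℤ.* Σ< K f
Σ<-*ˡ zero    c f = sym (ℤ.*-zeroʳ c)
Σ<-*ˡ (suc K) c f = trans (cong (ℤ._+_ (c ℤ.* f 0)) (Σ<-*ˡ K c (f ∘ suc))) (sym (ℤ.*-distribˡ-+ c (f 0) _))

Σ<-+ : ∀ K (f g : ℕ → ℤ) → Σ< K (λ k → f k ℤ.+ g k) ≡ Σ< K f ℤ.+ Σ< K g
Σ<-+ zero    f g = refl
Σ<-+ (suc K) f g = trans (cong (ℤ._+_ (f 0 ℤ.+ g 0)) (Σ<-+ K (f ∘ suc) (g ∘ suc)))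
  (solve 4 (λ a b c d → a :+ b :+ (c :+ d) := a :+ c :+ (b :+ d)) refl (f 0) (g 0) (Σ< K (f ∘ suc)) (Σ< K (g ∘ suc)))
  where open ℤ.+-*-Solver

Σ<-0 : ∀ K {f : ℕ → ℤ} → (∀ {k} → k < K → f k ≡ + 0) → Σ< K f ≡ + 0
Σ<-0 zero    f≡0 = refl
Σ<-0 (suc K) f≡0 = cong₂ ℤ._+_ (f≡0 (s≤s z≤n)) (Σ<-0 K (f≡0 ∘ s≤s))

Σ<-swap : ∀ J K (f : ℕ → ℕ → ℤ) → Σ< K (λ k → Σ< J (λ j → f j k)) ≡ Σ< J (λ j → Σ< K (f j))
Σ<-swap zero    K f = Σ<-0 K (λ _ → refl)
Σ<-swap (suc J) K f = trans (Σ<-+ K (f 0) _) (cong (ℤ._+_ (Σ< K (f 0))) (Σ<-swap J K (f ∘ suc)))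

Σ<-extend : ∀ K J {f : ℕ → ℤ} → (∀ k → K ≤ k → f k ≡ + 0) → Σ< (K + J) f ≡ Σ< K f
Σ<-extend zero    J f≡0 = Σ<-0 J (λ _ → f≡0 _ z≤n)
Σ<-extend (suc K) J {f} f≡0 = cong (ℤ._+_ (f 0)) (Σ<-extend K J (λ k K≤k → f≡0 (suc k) (s≤s K≤k)))

χ-even-suc : ∀ d → χ-even (suc d) ≡ + 1 ℤ.- χ-even d
χ-even-suc zero = refl
χ-even-suc (suc zero) = refl
χ-even-suc (suc (suc d)) = χ-even-suc d

sign : ℕ → ℤ
sign j = (ℤ.- + 1) ℤ.^ j

-- By `N-singleℤ`, for `c` at least `l` the first factor is twice `N [ suc l ] c` divided by 2^c.
term : ℕ → ℕ → ℕ → ℤ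
term l c b = (+ (c C l) ℤ.- + 1) ℤ.* + b

-- Induction on `d` with the size fixed. The recurrence for `S` = {l + 1} gives this count as a
-- product of a one-peak and a peakless count, minus the count with the second peak one place
-- earlier, minus the one-peak count. The first subtraction makes the sum alternate; the second
-- cancels at every other step and leaves the `χ-even` summand.
N-pair : ∀ l d e → let k = suc (l + d + e) in
  + 4 ℤ.* + N (suc l ∷ 2 + l + d ∷ []) k
  ≡ + (2 ^ k) ℤ.* (Σ< d (λ j → sign j ℤ.* term l (l + d ∸ j) (suc k C (e + suc j)))
                   ℤ.- + 2 ℤ.* χ-even (suc d) ℤ.* (+ (k C l) ℤ.- + 1))
-- Adjacent peaks cannot occur, and on the right the sum is empty and `χ-even 1` is 0.
N-pair l zero e = begin
  + 4 ℤ.* + N (suc l ∷ 2 + l + 0 ∷ []) k  ≡⟨ cong (λ z → + 4 ℤ.* + N (suc l ∷ 2 + z ∷ []) k) (+-identityʳ l) ⟩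
  + 4 ℤ.* + N (suc l ∷ 2 + l ∷ []) k      ≡⟨ cong (λ z → + 4 ℤ.* + z) (N-adjacent (suc l) k) ⟩
  + 0                                     ≡⟨ ℤ.*-zeroʳ (+ (2 ^ k)) ⟨
  + (2 ^ k) ℤ.* + 0                       ∎
  where
  open ≡-Reasoning
  k = suc (l + 0 + e)
N-pair l (suc d) e rewrite +-suc l d = begin
  + 4 ℤ.* + N₂
    ≡⟨ solve 3 (λ n₀ n₁ n₂ → con (+ 4) :* n₂ := con (+ 4) :* (n₀ :+ (n₁ :+ n₂)) :- con (+ 4) :* n₁ :- con (+ 2) :* (con (+ 2) :* n₀)) refl (+ N₀) (+ N₁) (+ N₂) ⟩
  + 4 ℤ.* + (N₀ + (N₁ + N₂)) ℤ.- + 4 ℤ.* + N₁ ℤ.- + 2 ℤ.* (+ 2 ℤ.* + N₀)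
    ≡⟨ cong₂ (λ x y → x ℤ.- + 4 ℤ.* + N₁ ℤ.- + 2 ℤ.* y) total single ⟩
  + p ℤ.* term l a c ℤ.- + 4 ℤ.* + N₁ ℤ.- + 2 ℤ.* (+ p ℤ.* u)
    ≡⟨ cong (λ x → + p ℤ.* term l a c ℤ.- x ℤ.- + 2 ℤ.* (+ p ℤ.* u)) ih ⟩
  + p ℤ.* term l a c ℤ.- + p ℤ.* (S ℤ.- + 2 ℤ.* x ℤ.* u) ℤ.- + 2 ℤ.* (+ p ℤ.* u)
    ≡⟨ solve 5 (λ p t s x u → p :* t :- p :* (s :- con (+ 2) :* x :* u) :- con (+ 2) :* (p :* u)
         := p :* (con (+ 1) :* t :+ con (ℤ.- + 1) :* s :- con (+ 2) :* (con (+ 1) :- x) :* u)) refl (+ p) (term l a c) S x u ⟩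
  + p ℤ.* (+ 1 ℤ.* term l a c ℤ.+ (ℤ.- + 1) ℤ.* S ℤ.- + 2 ℤ.* (+ 1 ℤ.- x) ℤ.* u)
    ≡⟨ cong₂ (λ s y → + p ℤ.* (+ 1 ℤ.* term l a c ℤ.+ s ℤ.- + 2 ℤ.* y ℤ.* u)) tail (sym (χ-even-suc (suc d))) ⟩
  + p ℤ.* (Σ< (suc d) f ℤ.- + 2 ℤ.* χ-even (2 + d) ℤ.* u) ∎
  where
  open ≡-Reasoning
  open ℤ.+-*-Solver
  a = suc (l + d)
  k = suc (a + e)
  p = 2 ^ k
  N₀ = N [ suc l ] k
  N₁ = N (suc l ∷ suc a ∷ []) k
  N₂ = N (suc l ∷ 2 + a ∷ []) k
  c = suc k C (e + 1)
  u = + (k C l) ℤ.- + 1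
  x = χ-even (suc d)
  f g : ℕ → ℤ
  f j = sign j ℤ.* term l (a ∸ j) (suc k C (e + suc j))
  g j = sign j ℤ.* term l (l + d ∸ j) (suc k C (suc e + suc j))
  S = Σ< d g

  -- The second peak is one place earlier, so `e` grows by one to keep the size.
  ih : + 4 ℤ.* + N₁ ≡ + p ℤ.* (S ℤ.- + 2 ℤ.* x ℤ.* u)
  ih = subst (λ z → + 4 ℤ.* + N (suc l ∷ suc a ∷ []) (suc z) ≡ + (2 ^ suc z) ℤ.*
         (Σ< d (λ j → sign j ℤ.* term l (l + d ∸ j) (suc (suc z) C (suc e + suc j)))
          ℤ.- + 2 ℤ.* x ℤ.* (+ (suc z C l) ℤ.- + 1)))
       (+-suc (l + d) e) (N-pair l d (suc e))

  single : + 2 ℤ.* + N₀ ≡ + p ℤ.* u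
  single = subst (λ z → + 2 ℤ.* + N [ suc l ] z ≡ + (2 ^ z) ℤ.* (+ (z C l) ℤ.- + 1))
    (trans (sym (+-assoc l (2 + d) e)) (cong (_+ e) (trans (+-suc l (suc d)) (cong suc (+-suc l d)))))
    (N-singleℤ l (2 + d + e))

  singleₐ : + 2 ℤ.* + N [ suc l ] a ≡ + (2 ^ a) ℤ.* (+ (a C l) ℤ.- + 1)
  singleₐ = subst (λ z → + 2 ℤ.* + N [ suc l ] z ≡ + (2 ^ z) ℤ.* (+ (z C l) ℤ.- + 1)) (+-suc l d) (N-singleℤ l (suc d))

  total : + 4 ℤ.* + (N₀ + (N₁ + N₂)) ≡ + p ℤ.* term l a c
  total = begin
    + 4 ℤ.* + (N₀ + (N₁ + N₂))
      ≡⟨ cong (λ z → + 4 ℤ.* + z) (N-recurrence a e [ suc l ] (s≤s (s≤s (m≤m+n l d)) ∷ [])) ⟨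
    + 4 ℤ.* + ((suc k C suc e) * (N [ suc l ] a * N [] e))
      ≡⟨ cong₂ (λ z w → + 4 ℤ.* + ((suc k C z) * (N [ suc l ] a * w))) (+-comm 1 e) (N-[] e) ⟩
    + 4 ℤ.* + (c * (N [ suc l ] a * 2 ^ e))
      ≡⟨ cong (+ 4 ℤ.*_) (trans (ℤ.pos-* c _) (cong (+ c ℤ.*_) (ℤ.pos-* (N [ suc l ] a) (2 ^ e)))) ⟩
    + 4 ℤ.* (+ c ℤ.* (+ N [ suc l ] a ℤ.* + (2 ^ e)))
      ≡⟨ solve 3 (λ c n q → con (+ 4) :* (c :* (n :* q)) := con (+ 2) :* (con (+ 2) :* n) :* q :* c) refl (+ c) (+ N [ suc l ] a) (+ (2 ^ e)) ⟩
    + 2 ℤ.* (+ 2 ℤ.* + N [ suc l ] a) ℤ.* + (2 ^ e) ℤ.* + c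
      ≡⟨ cong (λ z → + 2 ℤ.* z ℤ.* + (2 ^ e) ℤ.* + c) singleₐ ⟩
    + 2 ℤ.* (+ (2 ^ a) ℤ.* v) ℤ.* + (2 ^ e) ℤ.* + c
      ≡⟨ solve 4 (λ q v r c → con (+ 2) :* (q :* v) :* r :* c := con (+ 2) :* (q :* r) :* (v :* c)) refl (+ (2 ^ a)) v (+ (2 ^ e)) (+ c) ⟩
    + 2 ℤ.* (+ (2 ^ a) ℤ.* + (2 ^ e)) ℤ.* (v ℤ.* + c)
      ≡⟨ cong (ℤ._* (v ℤ.* + c)) (trans (cong (+ 2 ℤ.*_) (sym (ℤ.pos-* (2 ^ a) (2 ^ e)))) (sym (ℤ.pos-* 2 (2 ^ a * 2 ^ e)))) ⟩
    + (2 * (2 ^ a * 2 ^ e)) ℤ.* (v ℤ.* + c)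
      ≡⟨ cong (λ z → + (2 * z) ℤ.* (v ℤ.* + c)) (^-distribˡ-+-* 2 a e) ⟨
    + p ℤ.* (v ℤ.* + c) ∎
    where v = + (a C l) ℤ.- + 1

  tail : (ℤ.- + 1) ℤ.* S ≡ Σ< d (f ∘ suc)
  tail = trans (sym (Σ<-*ˡ d (ℤ.- + 1) g)) (Σ<-cong d λ {j} _ →
    trans (sym (ℤ.*-assoc (ℤ.- + 1) (sign j) _))
          (cong (λ z → sign (suc j) ℤ.* term l (l + d ∸ j) (suc k C z)) (sym (+-suc e (suc j)))))

-- Expansions in the basis C(e, k)

-- The sum in `IsPeakCoeffs`, with `e` standing for n - m: a Newton series with coefficients `g`,
-- truncated at `K`.
newton : ℕ → (ℕ → ℤ) → ℕ → ℤ
newton K g e = Σ< K (λ k → g k ℤ.* + (e C k))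

newton-cong : ∀ K {g h} e → (∀ k → g k ≡ h k) → newton K g e ≡ newton K h e
newton-cong K e g≡h = Σ<-cong K λ {k} _ → cong (ℤ._* + (e C k)) (g≡h k)

newton-+ : ∀ K g h e → newton K (λ k → g k ℤ.+ h k) e ≡ newton K g e ℤ.+ newton K h e
newton-+ K g h e = trans (Σ<-cong K λ {k} _ → ℤ.*-distribʳ-+ (+ (e C k)) (g k) (h k)) (Σ<-+ K _ _)

newton-*ˡ : ∀ K c g e → newton K (λ k → c ℤ.* g k) e ≡ c ℤ.* newton K g e
newton-*ˡ K c g e = trans (Σ<-cong K λ {k} _ → ℤ.*-assoc c (g k) (+ (e C k))) (Σ<-*ˡ K c _)

newton-Σ< : ∀ J K (g : ℕ → ℕ → ℤ) e → newton K (λ k → Σ< J (λ j → g j k)) e ≡ Σ< J (λ j → newton K (g j) e)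
newton-Σ< J K g e = trans (Σ<-cong K λ {k} _ → begin
  Σ< J (λ j → g j k) ℤ.* + (e C k)         ≡⟨ ℤ.*-comm (Σ< J (λ j → g j k)) _ ⟩
  + (e C k) ℤ.* Σ< J (λ j → g j k)         ≡⟨ Σ<-*ˡ J (+ (e C k)) _ ⟨
  Σ< J (λ j → + (e C k) ℤ.* g j k)         ≡⟨ Σ<-cong J (λ {j} _ → ℤ.*-comm (+ (e C k)) (g j k)) ⟩
  Σ< J (λ j → g j k ℤ.* + (e C k))         ∎) (Σ<-swap J K _)
  where open ≡-Reasoning

newton-0 : ∀ K g → newton (suc K) g 0 ≡ g 0
newton-0 K g = begin
  g 0 ℤ.* + 1 ℤ.+ Σ< K (λ k → g (suc k) ℤ.* + 0) ≡⟨ cong₂ ℤ._+_ (ℤ.*-identityʳ (g 0)) (Σ<-0 K (λ {k} _ → ℤ.*-zeroʳ (g (suc k)))) ⟩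
  g 0 ℤ.+ + 0                                    ≡⟨ ℤ.+-identityʳ (g 0) ⟩
  g 0                                            ∎
  where open ≡-Reasoning

-- By Pascal's rule the forward difference of a Newton series shifts its coefficients by one.
newton-suc : ∀ K g e → newton (suc K) g (suc e) ≡ newton (suc K) g e ℤ.+ newton K (g ∘ suc) e
newton-suc K g e = begin
  g 0 ℤ.* + 1 ℤ.+ Σ< K (λ k → g (suc k) ℤ.* + (suc e C suc k))
    ≡⟨ cong (ℤ._+_ (g 0 ℤ.* + 1)) (Σ<-cong K λ {k} _ → trans (cong (g (suc k) ℤ.*_) (pos-C-pascal e k)) (ℤ.*-distribˡ-+ (g (suc k)) _ _)) ⟩
  g 0 ℤ.* + 1 ℤ.+ Σ< K (λ k → g (suc k) ℤ.* + (e C k) ℤ.+ g (suc k) ℤ.* + (e C suc k))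
    ≡⟨ cong (ℤ._+_ (g 0 ℤ.* + 1)) (Σ<-+ K (λ k → g (suc k) ℤ.* + (e C k)) _) ⟩
  g 0 ℤ.* + 1 ℤ.+ (newton K (g ∘ suc) e ℤ.+ Σ< K (λ k → g (suc k) ℤ.* + (e C suc k)))
    ≡⟨ solve 3 (λ a b c → a :+ (b :+ c) := a :+ c :+ b) refl (g 0 ℤ.* + 1) (newton K (g ∘ suc) e) (Σ< K (λ k → g (suc k) ℤ.* + (e C suc k))) ⟩
  newton (suc K) g e ℤ.+ newton K (g ∘ suc) e ∎
  where
  open ≡-Reasoning
  open ℤ.+-*-Solver

-- Vandermonde's identity by induction on `e`: the difference in `newton-suc` raises `t` by one, and
-- Pascal's rule joins the two values. The hypothesis makes every term beyond the truncation zero.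
vandermonde : ∀ e M t K → M < K + t → newton K (λ k → + (M C (k + t))) e ≡ + ((e + M) C (e + t))
vandermonde e M t zero M<t = cong +_ (sym (k>n⇒nCk≡0 (+-monoʳ-< e M<t)))
vandermonde zero M t (suc K) M<K+t = newton-0 K (λ k → + (M C (k + t)))
vandermonde (suc e) M t (suc K) M<K+t = begin
  newton (suc K) g (suc e)                                ≡⟨ newton-suc K g e ⟩
  newton (suc K) g e ℤ.+ newton K (g ∘ suc) e             ≡⟨ cong₂ ℤ._+_ (vandermonde e M t (suc K) M<K+t)
    (trans (newton-cong K e (λ k → cong (λ z → + (M C z)) (sym (+-suc k t))))
           (vandermonde e M (suc t) K (subst (M <_) (sym (+-suc K t)) M<K+t))) ⟩
  + ((e + M) C (e + t)) ℤ.+ + ((e + M) C (e + suc t))     ≡⟨ cong (λ z → + ((e + M) C (e + t)) ℤ.+ + ((e + M) C z)) (+-suc e t) ⟩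
  + ((e + M) C (e + t)) ℤ.+ + ((e + M) C suc (e + t))     ≡⟨ pos-C-pascal (e + M) (e + t) ⟨
  + (suc (e + M) C suc (e + t))                           ∎
  where
  open ≡-Reasoning
  g : ℕ → ℤ
  g k = + (M C (k + t))

-- Only arguments from 1 on are given, since `IsPeakCoeffs` speaks of n > m. Differences of these
-- values eliminate all shifted coefficients by induction; the value at 1 then isolates `g 0`.
newton-injective : ∀ K g → (∀ k → K ≤ k → g k ≡ + 0) → (∀ e → newton K g (suc e) ≡ + 0) → ∀ k → g k ≡ + 0
newton-injective zero    g g≡0 _ k = g≡0 k z≤n
newton-injective (suc K) g g≡0 n≡0 = λ { zero → head ; (suc k) → tail k }
  where
  open ≡-Reasoning
  tail : ∀ k → g (suc k) ≡ + 0
  tail = newton-injective K (g ∘ suc) (λ k K≤k → g≡0 (suc k) (s≤s K≤k)) λ e → begin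
    newton K (g ∘ suc) (suc e)                               ≡⟨ ℤ.+-identityˡ _ ⟨
    + 0 ℤ.+ newton K (g ∘ suc) (suc e)                       ≡⟨ cong (ℤ._+ newton K (g ∘ suc) (suc e)) (n≡0 e) ⟨
    newton (suc K) g (suc e) ℤ.+ newton K (g ∘ suc) (suc e)  ≡⟨ newton-suc K g (suc e) ⟨
    newton (suc K) g (2 + e)                                 ≡⟨ n≡0 (suc e) ⟩
    + 0                                                      ∎
  head : g 0 ≡ + 0
  head = begin
    g 0                                                         ≡⟨ ℤ.*-identityʳ (g 0) ⟨
    g 0 ℤ.* + 1                                                 ≡⟨ ℤ.+-identityʳ _ ⟨
    g 0 ℤ.* + 1 ℤ.+ + 0                                         ≡⟨ cong (ℤ._+_ (g 0 ℤ.* + 1)) (Σ<-0 K (λ {k} _ → cong (ℤ._* + (1 C suc k)) (tail k))) ⟨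
    newton (suc K) g 1                                          ≡⟨ n≡0 0 ⟩
    + 0                                                         ∎

-- Uniqueness of the coefficient sequence.

2^-cancelˡ : ∀ n {i j} → + (2 ^ n) ℤ.* i ≡ + (2 ^ n) ℤ.* j → i ≡ j
2^-cancelˡ n = ℤ.*-cancelˡ-≡ (+ (2 ^ n)) _ _ ⦃ m^n≢0 2 n ⦄

-- The two sequences may have different support bounds; their difference is expanded up to the
-- common bound K + K′, where it represents zero at every positive argument.
peakCoeffs-unique : ∀ l m {c c′} → IsPeakCoeffs l m c → IsPeakCoeffs l m c′ → ∀ k → c k ≡ c′ k
peakCoeffs-unique l m {c} {c′} (K , c≡0 , count) (K′ , c′≡0 , count′) k =
  ℤ.i-j≡0⇒i≡j (c k) (c′ k) (newton-injective (K + K′) (λ k → c k ℤ.- c′ k) g≡0 n≡0 k)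
  where
  open ≡-Reasoning
  g≡0 : ∀ k → K + K′ ≤ k → c k ℤ.- c′ k ≡ + 0
  g≡0 k K≤k = cong₂ ℤ._-_ (c≡0 k (≤-trans (m≤m+n K K′) K≤k)) (c′≡0 k (≤-trans (m≤n+m K′ K) K≤k))

  agree : ∀ e → newton K c (suc e) ≡ newton K′ c′ (suc e)
  agree e = 2^-cancelˡ (m + suc e ∸ 3)
    (subst (λ x → + (2 ^ (m + suc e ∸ 3)) ℤ.* newton K c x ≡ + (2 ^ (m + suc e ∸ 3)) ℤ.* newton K′ c′ x)
      (m+n∸m≡n m (suc e)) (trans (sym (count (m + suc e) m<n)) (count′ (m + suc e) m<n)))
    where
    m<n : m < m + suc e
    m<n = m<m+n m (s≤s z≤n)

  n≡0 : ∀ e → newton (K + K′) (λ k → c k ℤ.- c′ k) (suc e) ≡ + 0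
  n≡0 e = begin
    newton (K + K′) (λ k → c k ℤ.- c′ k) (suc e)
      ≡⟨ newton-cong (K + K′) (suc e) (λ k → cong (ℤ._+_ (c k)) (sym (ℤ.-1*i≡-i (c′ k)))) ⟩
    newton (K + K′) (λ k → c k ℤ.+ ℤ.-1ℤ ℤ.* c′ k) (suc e)
      ≡⟨ newton-+ (K + K′) c _ (suc e) ⟩
    newton (K + K′) c (suc e) ℤ.+ newton (K + K′) (λ k → ℤ.-1ℤ ℤ.* c′ k) (suc e)
      ≡⟨ cong₂ ℤ._+_ (Σ<-extend K K′ (λ k K≤k → cong (ℤ._* + (suc e C k)) (c≡0 k K≤k)))
           (trans (newton-*ˡ (K + K′) ℤ.-1ℤ c′ (suc e)) (cong (ℤ.-1ℤ ℤ.*_)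
             (trans (cong (λ J → newton J c′ (suc e)) (+-comm K K′))
                    (Σ<-extend K′ K (λ k K≤k → cong (ℤ._* + (suc e C k)) (c′≡0 k K≤k)))))) ⟩
    newton K c (suc e) ℤ.+ ℤ.-1ℤ ℤ.* newton K′ c′ (suc e)
      ≡⟨ cong₂ ℤ._+_ (agree e) (ℤ.-1*i≡-i _) ⟩
    newton K′ c′ (suc e) ℤ.- newton K′ c′ (suc e)
      ≡⟨ ℤ.+-inverseʳ (newton K′ c′ (suc e)) ⟩
    + 0 ∎

-- formula (suc l) (2 + l + d), so that the two peaks are d + 1 apart.
coeff : ℕ → ℕ → ℕ → ℤ
coeff l d k = ℤ.- (+ 2 ℤ.* + (suc (l + d) C (k + suc d)) ℤ.* χ-even (suc d))
  ℤ.+ Σ< d (λ j → sign j ℤ.* term l (l + d ∸ j) ((2 + l + d) C (k + suc j)))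

formula≡coeff : ∀ l d k → formula (suc l) (2 + l + d) k ≡ coeff l d k
formula≡coeff l d k rewrite trans (cong (_∸ l) (sym (+-suc l d))) (m+n∸m≡n l (suc d)) =
  cong (ℤ._+_ (ℤ.- (+ 2 ℤ.* + (suc (l + d) C (k + suc d)) ℤ.* χ-even (suc d))))
    (Σ<-cong d λ {j} _ → cong₂ (λ a b → sign j ℤ.* term l a ((2 + l + d) C b))
      (trans (∸-+-assoc (2 + l + d) j 2) (cong (2 + l + d ∸_) (+-comm j 2)))
      (trans (+-assoc k j 1) (cong (λ z → k + z) (+-comm j 1))))

-- Newton coefficients of a constant function. They supply the summand `+ 2 ℤ.* χ-even (suc d)` by
-- which `N-pair` exceeds the expansion of `coeff`.
δ : ℤ → ℕ → ℤ
δ c zero    = c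
δ c (suc k) = + 0

newton-δ : ∀ K c e → newton (suc K) (δ c) e ≡ c
newton-δ K c e = trans (cong₂ ℤ._+_ (ℤ.*-identityʳ c) (Σ<-0 K (λ _ → refl))) (ℤ.+-identityʳ c)

-- Vandermonde's identity applies to each summand of `coeff` separately; symmetry of binomials
-- brings the result for the `χ-even` summand to lower index `l`.
newton-coeff : ∀ l d e → let k = suc (l + d + e) in
  newton (2 + l + d) (coeff l d) e
  ≡ Σ< d (λ j → sign j ℤ.* term l (l + d ∸ j) (suc k C (e + suc j))) ℤ.- + 2 ℤ.* χ-even (suc d) ℤ.* + (k C l)
newton-coeff l d e = begin
  newton K (coeff l d) e
    ≡⟨ newton-+ K (λ k → ℤ.- (+ 2 ℤ.* + (suc (l + d) C (k + suc d)) ℤ.* x))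
         (λ k → Σ< d (λ j → sign j ℤ.* term l (l + d ∸ j) (K C (k + suc j)))) e ⟩
  newton K (λ k → ℤ.- (+ 2 ℤ.* + (suc (l + d) C (k + suc d)) ℤ.* x)) e
    ℤ.+ newton K (λ k → Σ< d (λ j → sign j ℤ.* term l (l + d ∸ j) (K C (k + suc j)))) e
    ≡⟨ cong₂ ℤ._+_ first (trans (newton-Σ< d K (λ j k → sign j ℤ.* term l (l + d ∸ j) (K C (k + suc j))) e) (Σ<-cong d (λ {j} _ → second j))) ⟩
  ℤ.- (+ 2 ℤ.* x ℤ.* + (suc (l + d + e) C l)) ℤ.+ S
    ≡⟨ ℤ.+-comm (ℤ.- (+ 2 ℤ.* x ℤ.* + (suc (l + d + e) C l))) S ⟩
  S ℤ.- + 2 ℤ.* x ℤ.* + (suc (l + d + e) C l) ∎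
  where
  open ≡-Reasoning
  open ℤ.+-*-Solver
  K = 2 + l + d
  x = χ-even (suc d)
  S = Σ< d (λ j → sign j ℤ.* term l (l + d ∸ j) ((2 + l + d + e) C (e + suc j)))

  binom : (e + suc (l + d)) C (e + suc d) ≡ suc (l + d + e) C l
  binom = begin
    (e + suc (l + d)) C (e + suc d)    ≡⟨ cong (_C (e + suc d)) (solveℕ 3 (λ e l d → e ⊕ (con′ 1 ⊕ (l ⊕ d)) ⊜ l ⊕ (e ⊕ (con′ 1 ⊕ d))) refl e l d) ⟩
    (l + (e + suc d)) C (e + suc d)    ≡⟨ C-sym l (e + suc d) ⟨
    (l + (e + suc d)) C l              ≡⟨ cong (_C l) (solveℕ 3 (λ e l d → l ⊕ (e ⊕ (con′ 1 ⊕ d)) ⊜ con′ 1 ⊕ (l ⊕ d ⊕ e)) refl e l d) ⟩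
    suc (l + d + e) C l                ∎
    where open +-*-Solver using () renaming (solve to solveℕ; _:+_ to _⊕_; _:=_ to _⊜_; con to con′)

  first : newton K (λ k → ℤ.- (+ 2 ℤ.* + (suc (l + d) C (k + suc d)) ℤ.* x)) e ≡ ℤ.- (+ 2 ℤ.* x ℤ.* + (suc (l + d + e) C l))
  first = begin
    newton K (λ k → ℤ.- (+ 2 ℤ.* + (suc (l + d) C (k + suc d)) ℤ.* x)) e
      ≡⟨ newton-cong K e (λ k → solve 2 (λ b x → :- (con (+ 2) :* b :* x) := :- (con (+ 2) :* x) :* b) refl (+ (suc (l + d) C (k + suc d))) x) ⟩
    newton K (λ k → ℤ.- (+ 2 ℤ.* x) ℤ.* + (suc (l + d) C (k + suc d))) e
      ≡⟨ newton-*ˡ K (ℤ.- (+ 2 ℤ.* x)) (λ k → + (suc (l + d) C (k + suc d))) e ⟩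
    ℤ.- (+ 2 ℤ.* x) ℤ.* newton K (λ k → + (suc (l + d) C (k + suc d))) e
      ≡⟨ cong (ℤ.- (+ 2 ℤ.* x) ℤ.*_) (trans (vandermonde e (suc (l + d)) (suc d) K (m≤m+n K (suc d))) (cong +_ binom)) ⟩
    ℤ.- (+ 2 ℤ.* x) ℤ.* + (suc (l + d + e) C l)
      ≡⟨ ℤ.neg-distribˡ-* (+ 2 ℤ.* x) _ ⟨
    ℤ.- (+ 2 ℤ.* x ℤ.* + (suc (l + d + e) C l)) ∎

  second : ∀ j → newton K (λ k → sign j ℤ.* term l (l + d ∸ j) (K C (k + suc j))) e
    ≡ sign j ℤ.* term l (l + d ∸ j) ((2 + l + d + e) C (e + suc j))
  second j = begin
    newton K (λ k → sign j ℤ.* term l (l + d ∸ j) (K C (k + suc j))) e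
      ≡⟨ newton-*ˡ K (sign j) (λ k → term l (l + d ∸ j) (K C (k + suc j))) e ⟩
    sign j ℤ.* newton K (λ k → term l (l + d ∸ j) (K C (k + suc j))) e
      ≡⟨ cong (sign j ℤ.*_) (newton-*ˡ K (+ ((l + d ∸ j) C l) ℤ.- + 1) (λ k → + (K C (k + suc j))) e) ⟩
    sign j ℤ.* ((+ ((l + d ∸ j) C l) ℤ.- + 1) ℤ.* newton K (λ k → + (K C (k + suc j))) e)
      ≡⟨ cong (λ z → sign j ℤ.* ((+ ((l + d ∸ j) C l) ℤ.- + 1) ℤ.* z)) (vandermonde e K (suc j) K (m<m+n K (s≤s z≤n))) ⟩
    sign j ℤ.* term l (l + d ∸ j) ((e + K) C (e + suc j))
      ≡⟨ cong (λ z → sign j ℤ.* term l (l + d ∸ j) (z C (e + suc j))) (+-comm e K) ⟩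
    sign j ℤ.* term l (l + d ∸ j) ((K + e) C (e + suc j)) ∎

N-newton : ∀ l d e → let k = suc (l + d + e) in
  + 4 ℤ.* + N (suc l ∷ 2 + l + d ∷ []) k
  ≡ + (2 ^ k) ℤ.* newton (2 + l + d) (λ i → coeff l d i ℤ.+ δ (+ 2 ℤ.* χ-even (suc d)) i) e
N-newton l d e = trans (N-pair l d e) (cong (+ (2 ^ suc (l + d + e)) ℤ.*_) (sym (begin
  newton (2 + l + d) (λ i → coeff l d i ℤ.+ δ y i) e
    ≡⟨ newton-+ (2 + l + d) (coeff l d) (δ y) e ⟩
  newton (2 + l + d) (coeff l d) e ℤ.+ newton (2 + l + d) (δ y) e
    ≡⟨ cong₂ ℤ._+_ (newton-coeff l d e) (newton-δ (suc (l + d)) y e) ⟩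
  S ℤ.- y ℤ.* b ℤ.+ y
    ≡⟨ solve 3 (λ s y b → s :- y :* b :+ y := s :- y :* (b :- con (+ 1))) refl S y b ⟩
  S ℤ.- y ℤ.* (b ℤ.- + 1) ∎)))
  where
  open ≡-Reasoning
  open ℤ.+-*-Solver
  y = + 2 ℤ.* χ-even (suc d)
  b = + (suc (l + d + e) C l)
  S = Σ< d (λ j → sign j ℤ.* term l (l + d ∸ j) ((2 + l + d + e) C (e + suc j)))

-- The constant coefficient is read off at n = m, where m cannot be a peak.
coeff-zero : ∀ l d → coeff l d 0 ℤ.+ + 2 ℤ.* χ-even (suc d) ≡ + 0
coeff-zero l d = 2^-cancelˡ k (begin
  + (2 ^ k) ℤ.* (coeff l d 0 ℤ.+ + 2 ℤ.* χ-even (suc d)) ≡⟨ cong (+ (2 ^ k) ℤ.*_) (newton-0 (suc (l + d)) h) ⟨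
  + (2 ^ k) ℤ.* newton (2 + l + d) h 0                  ≡⟨ N-newton l d 0 ⟨
  + 4 ℤ.* + N (suc l ∷ 2 + l + d ∷ []) k ≡⟨ cong (λ z → + 4 ℤ.* + N (suc l ∷ 2 + z ∷ []) k) (+-identityʳ (l + d)) ⟨
  + 4 ℤ.* + N (suc l ∷ suc k ∷ []) k     ≡⟨ cong (λ z → + 4 ℤ.* + z) (N-last (suc l) k) ⟩
  + 0                                    ≡⟨ ℤ.*-zeroʳ (+ (2 ^ k)) ⟨
  + (2 ^ k) ℤ.* + 0                      ∎)
  where
  open ≡-Reasoning
  k = suc (l + d + 0)
  h : ℕ → ℤ
  h i = coeff l d i ℤ.+ δ (+ 2 ℤ.* χ-even (suc d)) i

formulaC≡coeff : ∀ l d k → formulaC (suc l) (2 + l + d) k ≡ coeff l d k ℤ.+ δ (+ 2 ℤ.* χ-even (suc d)) k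
formulaC≡coeff l d zero    = sym (coeff-zero l d)
formulaC≡coeff l d (suc k) = trans (formula≡coeff l d (suc k)) (sym (ℤ.+-identityʳ _))

coeff-support : ∀ l d k → 2 + l + d ≤ k → coeff l d k ≡ + 0
coeff-support l d k m≤k = cong₂ ℤ._+_
  (cong (λ z → ℤ.- (+ 2 ℤ.* + z ℤ.* χ-even (suc d))) (k>n⇒nCk≡0 (≤-trans m≤k (m≤m+n k (suc d)))))
  (Σ<-0 d λ {j} _ → begin
    sign j ℤ.* term l (l + d ∸ j) ((2 + l + d) C (k + suc j))
      ≡⟨ cong (λ z → sign j ℤ.* term l (l + d ∸ j) z) (k>n⇒nCk≡0 (≤-<-trans m≤k (m<m+n k (s≤s z≤n)))) ⟩
    sign j ℤ.* term l (l + d ∸ j) 0 ≡⟨ cong (sign j ℤ.*_) (ℤ.*-zeroʳ (+ ((l + d ∸ j) C l) ℤ.- + 1)) ⟩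
    sign j ℤ.* + 0                  ≡⟨ ℤ.*-zeroʳ (sign j) ⟩
    + 0                             ∎)
  where open ≡-Reasoning

formulaC-isPeakCoeffs : ∀ l d → IsPeakCoeffs (2 + l) (3 + l + d) (formulaC (2 + l) (3 + l + d))
formulaC-isPeakCoeffs l d = m , support , count
  where
  open ≡-Reasoning
  m = 3 + l + d
  h : ℕ → ℤ
  h i = coeff (suc l) d i ℤ.+ δ (+ 2 ℤ.* χ-even (suc d)) i

  support : ∀ k → m ≤ k → formulaC (2 + l) m k ≡ + 0
  support (suc k) m≤k = trans (formula≡coeff (suc l) d (suc k)) (coeff-support (suc l) d (suc k) m≤k)

  -- The factor 4 is the quotient of 2^(n-1), as in `N-newton`, and 2^(n-3), as in `IsPeakCoeffs`,
  -- for n = m + e.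
  count₀ : ∀ e → + countP (2 + l) m (m + e) ≡ + (2 ^ (l + d + e)) ℤ.* newton m (formulaC (2 + l) m) e
  count₀ e = ℤ.*-cancelˡ-≡ (+ 4) _ _ (begin
    + 4 ℤ.* + countP (2 + l) m (m + e)
      ≡⟨ cong (λ z → + 4 ℤ.* + z) (countP≡N (2 + l) m (2 + l + d + e)) ⟩
    + 4 ℤ.* + N (2 + l ∷ m ∷ []) (2 + l + d + e)
      ≡⟨ N-newton (suc l) d e ⟩
    + (2 * (2 * 2 ^ (l + d + e))) ℤ.* newton m h e
      ≡⟨ cong₂ ℤ._*_ (trans (cong +_ (sym (*-assoc 2 2 (2 ^ (l + d + e))))) (ℤ.pos-* 4 (2 ^ (l + d + e)))) (newton-cong m e (λ k → sym (formulaC≡coeff (suc l) d k))) ⟩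
    + 4 ℤ.* + (2 ^ (l + d + e)) ℤ.* newton m (formulaC (2 + l) m) e
      ≡⟨ ℤ.*-assoc (+ 4) (+ (2 ^ (l + d + e))) _ ⟩
    + 4 ℤ.* (+ (2 ^ (l + d + e)) ℤ.* newton m (formulaC (2 + l) m) e) ∎)

  count : ∀ n → m < n → + countP (2 + l) m n ≡ + (2 ^ (n ∸ 3)) ℤ.* newton m (formulaC (2 + l) m) (n ∸ m)
  count n m<n = subst (λ n′ → + countP (2 + l) m n′ ≡ + (2 ^ (n′ ∸ 3)) ℤ.* newton m (formulaC (2 + l) m) (n ∸ m))
    (m+[n∸m]≡n (<⇒≤ m<n)) (count₀ (n ∸ m))

-- Nonnegativity

-- `s` is at least as far from n/2 as `r`. After Pascal's rule the terms are paired crosswise,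
-- C(n,s) with C(n,r+1) and C(n,s+1) with C(n,r); both pairs have index sum r + s + 1, so the
-- induction applies.
C-far-≤ : ∀ n {r s} → r ≤ s → n ≤ r + s → n C s ≤ n C r
C-far-≤ zero {s = zero} z≤n _ = ≤-refl
C-far-≤ zero {s = suc s} _ _ = z≤n
C-far-≤ (suc n) {zero} {suc s} _ (s≤s n≤s) with m≤n⇒m<n∨m≡n n≤s
... | inj₁ n<s  = ≤-trans (≤-reflexive (k>n⇒nCk≡0 (s≤s n<s))) z≤n
... | inj₂ refl = ≤-reflexive (nCn≡1 (suc n))
C-far-≤ (suc n) {suc r} {suc s} (s≤s r≤s) (s≤s n≤) with m≤n⇒m<n∨m≡n r≤s
... | inj₂ refl = ≤-refl
... | inj₁ r<s  = begin
  suc n C suc s          ≡⟨ nCk+nC[k+1]≡[n+1]C[k+1] n s ⟨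
  n C s + n C suc s      ≤⟨ +-mono-≤ (C-far-≤ n r<s (subst (n ≤_) (+-suc r s) n≤)) (C-far-≤ n (m≤n⇒m≤1+n r≤s) n≤) ⟩
  n C suc r + n C r      ≡⟨ +-comm (n C suc r) (n C r) ⟩
  n C r + n C suc r      ≡⟨ nCk+nC[k+1]≡[n+1]C[k+1] n r ⟩
  suc n C suc r          ∎
  where open ≤-Reasoning

C-suc-≤ : ∀ n k → n C k ≤ suc n C k
C-suc-≤ n zero    = ≤-refl
C-suc-≤ n (suc k) = subst (n C suc k ≤_) (nCk+nC[k+1]≡[n+1]C[k+1] n k) (m≤n+m _ _)

C-monoˡ-≤ : ∀ k {m n} → m ≤ n → m C k ≤ n C k
C-monoˡ-≤ k m≤n = go (≤⇒≤′ m≤n)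
  where
  go : ∀ {m n} → m ≤′ n → m C k ≤ n C k
  go ≤′-refl       = ≤-refl
  go (≤′-step m≤n) = ≤-trans (go m≤n) (C-suc-≤ _ k)

C-positive : ∀ {n k} → k ≤ n → 1 ≤ n C k
C-positive {n} {k} k≤n = subst (_≤ n C k) (nCn≡1 k) (C-monoˡ-≤ k k≤n)

-- Consecutive terms are paired from the front with nonnegative differences. For odd `J` the last
-- term is left over and bounds `z`; for even `J` the left side is 0.
alternating-≥ : ∀ J (F : ℕ → ℕ) z →
  (∀ j → suc j < J → F (suc j) ≤ F j) → (∀ j → J ≡ suc j → z ≤ F j) →
  + z ℤ.* χ-even (suc J) ℤ.≤ Σ< J (λ j → sign j ℤ.* + F j)
alternating-≥ zero F z _ _ = ℤ.≤-reflexive (ℤ.*-zeroʳ (+ z))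
alternating-≥ (suc zero) F z _ last = begin
  + z ℤ.* + 1           ≡⟨ ℤ.*-identityʳ (+ z) ⟩
  + z                   ≤⟨ ℤ.+≤+ (last 0 refl) ⟩
  + F 0                 ≡⟨ solve 1 (λ f → f := con (+ 1) :* f :+ con (+ 0)) refl (+ F 0) ⟩
  + 1 ℤ.* + F 0 ℤ.+ + 0 ∎
  where
  open ℤ.≤-Reasoning
  open ℤ.+-*-Solver
alternating-≥ (suc (suc J)) F z anti last = begin
  + z ℤ.* χ-even (suc J)
    ≤⟨ alternating-≥ J (F ∘ suc ∘ suc) z (λ j j<J → anti (2 + j) (s≤s (s≤s j<J))) (λ j e → last (2 + j) (cong (suc ∘ suc) e)) ⟩
  S                                     ≡⟨ ℤ.+-identityˡ S ⟨
  + 0 ℤ.+ S                             ≤⟨ ℤ.+-monoˡ-≤ S (ℤ.i≤j⇒0≤j-i (ℤ.+≤+ (anti 0 (s≤s (s≤s z≤n))))) ⟩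
  + F 0 ℤ.- + F 1 ℤ.+ S                 ≡⟨ solve 3 (λ a b s → a :- b :+ s := con (+ 1) :* a :+ (con (ℤ.- + 1) :* b :+ s)) refl (+ F 0) (+ F 1) S ⟩
  + 1 ℤ.* + F 0 ℤ.+ ((ℤ.- + 1) ℤ.* + F 1 ℤ.+ S)
    ≡⟨ cong (λ s → + 1 ℤ.* + F 0 ℤ.+ ((ℤ.- + 1) ℤ.* + F 1 ℤ.+ s)) (Σ<-cong J λ {j} _ →
         solve 2 (λ s f → s :* f := con (ℤ.- + 1) :* (con (ℤ.- + 1) :* s) :* f) refl (sign j) (+ F (2 + j))) ⟩
  Σ< (2 + J) (λ j → sign j ℤ.* + F j)   ∎
  where
  open ℤ.≤-Reasoning
  open ℤ.+-*-Solver
  S = Σ< J (λ j → sign j ℤ.* + F (2 + j))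

-- The hypothesis puts the relevant lower indices beyond the middle of their rows, so the terms
-- decrease and the last one dominates the negative summand `z`.
coeff-nonneg : ∀ l d k → suc l + d ≤ 2 * k → + 0 ℤ.≤ coeff (suc l) d k
coeff-nonneg l d k m-2≤2k = subst (+ 0 ℤ.≤_) (sym eq) (ℤ.i≤j⇒0≤j-i (alternating-≥ d F z anti last))
  where
  L = suc l
  m = 2 + L + d
  z = 2 * (suc (L + d) C (k + suc d))
  F : ℕ → ℕ
  F j = ((L + d ∸ j) C L ∸ 1) * (m C (k + suc j))

  doubled : ∀ i j → 2 * k + (i + j) ≡ (k + i) + (k + j)
  doubled = solve 3 (λ k i j → con 2 :* k :+ (i :+ j) := (k :+ i) :+ (k :+ j)) refl k
    where open +-*-Solver

  C-decreasing : ∀ n i j → i ≤ j → n ≤ L + d + (i + j) → n C (k + j) ≤ n C (k + i)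
  C-decreasing n i j i≤j n≤ = C-far-≤ n (+-monoʳ-≤ k i≤j)
    (subst (n ≤_) (doubled i j) (≤-trans n≤ (+-monoˡ-≤ (i + j) m-2≤2k)))

  -- Both factors decrease; for the binomials, (k + j + 1) + (k + j + 2) is at least m because 2k is
  -- at least m - 2.
  anti : ∀ j → suc j < d → F (suc j) ≤ F j
  anti j _ = *-mono-≤ (∸-monoˡ-≤ 1 (C-monoˡ-≤ L (∸-monoʳ-≤ (L + d) (n≤1+n j))))
    (C-decreasing m (suc j) (2 + j) (n≤1+n _)
      (subst (_≤ L + d + (suc j + (2 + j))) (+-comm (L + d) 2) (+-monoʳ-≤ (L + d) (m≤n⇒m≤o+n (suc j) (s≤s (s≤s z≤n))))))

  -- C(m-1,k+j+2) is at most C(m-1,k+j) and at most C(m-1,k+j+1), whose sum is C(m,k+j+1). The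
  -- remaining factor C(L+1,L) - 1 is at least 1 because `L` is positive, that is, the first peak is
  -- at least 2.
  last : ∀ j → d ≡ suc j → z ≤ F j
  last j refl = begin
    2 * (n C (k + (2 + j)))                       ≡⟨ cong (_+_ (n C (k + (2 + j)))) (+-identityʳ _) ⟩
    n C (k + (2 + j)) + n C (k + (2 + j))         ≤⟨ +-mono-≤ (C-decreasing n j (2 + j) (m≤n+m j 2) bound)
                                                     (C-decreasing n (suc j) (2 + j) (n≤1+n _) (≤-trans bound (+-monoʳ-≤ (L + suc j) (n≤1+n _)))) ⟩
    n C (k + j) + n C (k + suc j)                 ≡⟨ cong (λ i → n C (k + j) + n C i) (+-suc k j) ⟩
    n C (k + j) + n C suc (k + j)                 ≡⟨ nCk+nC[k+1]≡[n+1]C[k+1] n (k + j) ⟩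
    m C suc (k + j)                               ≡⟨ cong (m C_) (+-suc k j) ⟨
    m C (k + suc j)                               ≡⟨ *-identityˡ _ ⟨
    1 * (m C (k + suc j))                         ≤⟨ *-monoˡ-≤ (m C (k + suc j)) two ⟩
    F j                                           ∎
    where
    open ≤-Reasoning
    n = suc (L + d)
    bound : n ≤ L + suc j + (j + (2 + j))
    bound = subst (_≤ L + suc j + (j + (2 + j))) (+-comm (L + suc j) 1) (+-monoʳ-≤ (L + suc j) (m≤n⇒m≤o+n j (s≤s z≤n)))
    two : 1 ≤ (L + suc j ∸ j) C L ∸ 1
    two = ∸-monoˡ-≤ 1 (begin
      2                        ≤⟨ +-mono-≤ (C-positive (n≤1+n l)) (C-positive (≤-refl {L})) ⟩
      L C l + L C suc l        ≡⟨ nCk+nC[k+1]≡[n+1]C[k+1] L l ⟩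
      suc L C L                ≡⟨ cong (_C L) (trans (cong (_∸ j) (+-suc L j)) (m+n∸n≡m (suc L) j)) ⟨
      (L + suc j ∸ j) C L      ∎)

  eq : coeff L d k ≡ Σ< d (λ j → sign j ℤ.* + F j) ℤ.- + z ℤ.* χ-even (suc d)
  eq = trans (ℤ.+-comm (ℤ.- (+ 2 ℤ.* + (suc (L + d) C (k + suc d)) ℤ.* χ-even (suc d))) _) (cong₂ ℤ._-_
    (Σ<-cong d λ {j} j<d → cong (sign j ℤ.*_) (trans
      (cong (ℤ._* + (m C (k + suc j))) (natural j (<⇒≤ j<d)))
      (sym (ℤ.pos-* ((L + d ∸ j) C L ∸ 1) (m C (k + suc j))))))
    (cong (ℤ._* χ-even (suc d)) (sym (ℤ.pos-* 2 (suc (L + d) C (k + suc d))))))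
    where
    -- The upper index stays at least `L`, so the binomial is positive and truncated subtraction is
    -- exact.
    natural : ∀ j → j ≤ d → + ((L + d ∸ j) C L) ℤ.- + 1 ≡ + ((L + d ∸ j) C L ∸ 1)
    natural j j≤d = trans (ℤ.m-n≡m⊖n ((L + d ∸ j) C L) 1) (ℤ.⊖-≥ (C-positive (subst (L ≤_) (sym (+-∸-assoc L j≤d)) (m≤m+n L (d ∸ j)))))

theorem5p5 : (l m : ℕ) → 2 ≤ l → l + 2 ≤ m →
    IsPeakCoeffs l m (formulaC l m) ×
    ((c : ℕ → ℤ) → IsPeakCoeffs l m c →
    (c 0 ≡ + 0) ×
    ((k : ℕ) → 1 ≤ k → c k ≡ formula l m k) ×
    ((k : ℕ) → m ∸ 2 ≤ 2 * k → + 0 ℤ.≤ c k))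
theorem5p5 (suc (suc l)) m (s≤s (s≤s z≤n)) l+2≤m = subst Claim m≡ (isCoeffs , properties)
  where
  -- The peaks are d + 1 apart, and `l+2≤m` is what allows `d` to be a successor.
  d = suc (m ∸ (2 + l + 2))
  m′ = 3 + l + d

  Claim : ℕ → Set
  Claim m = IsPeakCoeffs (2 + l) m (formulaC (2 + l) m) ×
    ((c : ℕ → ℤ) → IsPeakCoeffs (2 + l) m c →
    (c 0 ≡ + 0) ×
    ((k : ℕ) → 1 ≤ k → c k ≡ formula (2 + l) m k) ×
    ((k : ℕ) → m ∸ 2 ≤ 2 * k → + 0 ℤ.≤ c k))

  m≡ : m′ ≡ m
  m≡ = trans (solve 2 (λ l o → con 3 :+ l :+ (con 1 :+ o) := con 2 :+ l :+ con 2 :+ o) refl l (m ∸ (2 + l + 2))) (m+[n∸m]≡n l+2≤m)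
    where open +-*-Solver

  isCoeffs : IsPeakCoeffs (2 + l) m′ (formulaC (2 + l) m′)
  isCoeffs = formulaC-isPeakCoeffs l d

  properties : (c : ℕ → ℤ) → IsPeakCoeffs (2 + l) m′ c →
    (c 0 ≡ + 0) ×
    ((k : ℕ) → 1 ≤ k → c k ≡ formula (2 + l) m′ k) ×
    ((k : ℕ) → m′ ∸ 2 ≤ 2 * k → + 0 ℤ.≤ c k)
  properties c isC = c≡ 0 , (λ { (suc k) _ → c≡ (suc k) }) , nonneg
    where
    c≡ : ∀ k → c k ≡ formulaC (2 + l) m′ k
    c≡ = peakCoeffs-unique (2 + l) m′ isC isCoeffs
    nonneg : ∀ k → m′ ∸ 2 ≤ 2 * k → + 0 ℤ.≤ c k
    -- At k = 0 the hypothesis would say that 1 + l + d is at most 0; for positive `k` the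
    -- coefficient is given by `coeff`.
    nonneg zero ()
    nonneg (suc k) h = subst (+ 0 ℤ.≤_) (sym (trans (c≡ (suc k)) (formula≡coeff (suc l) d (suc k)))) (coeff-nonneg l d (suc k) h)
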